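{- Triangle-freeness can be tested in $O(1)$ rounds in the CONGEST model, with a constant independent of $\epsilon$, $n$ and $m$, whenever $\min\{m^{ -1/3},\, n/m\}\le \epsilon\le 1$, where $n$ is the number of nodes and $m$ is the number of edges of the network graph.
   Context: CONGEST model: the network is an undirected graph $G=(V,E)$ with $n=|V|$ nodes and $m=|E|$ edges, nodes have unique $O(\log n)$-bit identifiers; computation is synchronous, and in each round every node may send $O(\log n)$ bits over each incident edge; nodes have private randomness. $G$ is triangle-free if it contains no triangle ($K_3$) as a subgraph. $G$ is $\epsilon$-far from a property if at least $\epsilon|E|$ edges must be added to or removed from $E$ to obtain a graph with the property. Testing triangle-freeness with parameter $\epsilon$: if $G$ is triangle-free then with probability at least $2/3$ all nodes accept; if $G$ is $\epsilon$-far from triangle-free then with probability at least $2/3$ some node rejects. -}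

module Defs where

open import Data.Bool using (Bool; true; false)
import Data.Bool.Properties as 𝔹
open import Data.Fin as Fin using (Fin)
import Data.Fin.Properties as Fin
import Data.Integer as ℤ
open import Data.List using (List; []; _∷_; [_]; length; filter; allFin; cartesianProduct; cartesianProductWith)
open import Data.Nat as ℕ using (ℕ; zero; suc)
import Data.Nat.Properties as ℕ
open import Data.Product using (∃; ∃-syntax; _×_; _,_; proj₁; proj₂)
open import Data.Rational using (ℚ; 0ℚ; 1ℚ; _+_; _-_; _*_; -_; _<_; _≤_; _/_; nonNegative; positive)
import Data.Rational.Properties as ℚ
import Data.Rational.Unnormalised as ℚᵘ
import Data.Rational.Unnormalised.Properties as ℚᵘ
open import Data.Sum using (_⊎_; inj₁; inj₂)
open import Data.Vec as Vec using (Vec; []; _∷_; lookup)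
open import Function.Bundles using (_↔_; module Inverse)
open import Function.Definitions using (Injective)
open import Level using (0ℓ)
open import Relation.Binary using (tri<; tri≈; tri>)
open import Relation.Binary.PropositionalEquality using (_≡_; refl; sym; trans; subst)
open import Relation.Nullary using (¬_; yes; no; ¬?; contradiction)
open import Relation.Unary using (Pred; Decidable)

-- lower x q means q < x, and upper x q means x < q.
record ℝ : Set₁ where
  field
    lower upper     : Pred ℚ 0ℓ
    lower-inhabited : ∃ lower
    upper-inhabited : ∃ upper
    lower-closed    : ∀ {q r} → q < r → lower r → lower q
    upper-closed    : ∀ {q r} → q < r → upper q → upper r
    lower-open      : ∀ {q} → lower q → ∃[ r ] q < r × lower r
    upper-open      : ∀ {r} → upper r → ∃[ q ] q < r × upper q
    disjoint        : ∀ {q} → ¬ (lower q × upper q)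
    located         : ∀ {q r} → q < r → lower q ⊎ upper r

open ℝ public

infix 4 _≤ℝ_
_≤ℝ_ : ℝ → ℝ → Set
x ≤ℝ y = ∀ {q} → lower x q → lower y q

private
  q-1<q : ∀ q → q - 1ℚ < q
  q-1<q q = subst (q - 1ℚ <_) (ℚ.+-identityʳ q) (ℚ.+-monoʳ-< q (ℚ.negative⁻¹ (- 1ℚ)))

  q<q+1 : ∀ q → q < q + 1ℚ
  q<q+1 q = subst (_< q + 1ℚ) (ℚ.+-identityʳ q) (ℚ.+-monoʳ-< q (ℚ.positive⁻¹ 1ℚ))

fromℚ : ℚ → ℝ
fromℚ a = record
  { lower           = _< a
  ; upper           = a <_
  ; lower-inhabited = a - 1ℚ , q-1<q a
  ; upper-inhabited = a + 1ℚ , q<q+1 a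
  ; lower-closed    = ℚ.<-trans
  ; upper-closed    = λ q<r a<q → ℚ.<-trans a<q q<r
  ; lower-open      = ℚ.<-dense
  ; upper-open      = λ a<r → let s , a<s , s<r = ℚ.<-dense a<r in s , s<r , a<s
  ; disjoint        = λ (q<a , a<q) → ℚ.<-asym q<a a<q
  ; located         = λ {q} q<r → loc q q<r
  }
  where
  loc : ∀ q {r} → q < r → q < a ⊎ a < r
  loc q q<r with q ℚ.<? a
  ... | yes q<a = inj₁ q<a
  ... | no  q≮a = inj₂ (ℚ.≤-<-trans (ℚ.≮⇒≥ q≮a) q<r)

min : ℝ → ℝ → ℝ
min x y = record
  { lower           = λ q → lower x q × lower y q
  ; upper           = λ q → upper x q ⊎ upper y q
  ; lower-inhabited =
      let q , x∋q = lower-inhabited x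
          r , y∋r = lower-inhabited y
          s , s<q , s<r = below q r
      in s , lower-closed x s<q x∋q , lower-closed y s<r y∋r
  ; upper-inhabited = let q , x∋q = upper-inhabited x in q , inj₁ x∋q
  ; lower-closed    = λ q<r (x∋r , y∋r) → lower-closed x q<r x∋r , lower-closed y q<r y∋r
  ; upper-closed    = λ q<r → λ where
      (inj₁ x∋q) → inj₁ (upper-closed x q<r x∋q)
      (inj₂ y∋q) → inj₂ (upper-closed y q<r y∋q)
  ; lower-open      = λ (x∋q , y∋q) → open-min (lower-open x x∋q) (lower-open y y∋q)
  ; upper-open      = λ where
      (inj₁ x∋r) → let q , q<r , x∋q = upper-open x x∋r in q , q<r , inj₁ x∋q
      (inj₂ y∋r) → let q , q<r , y∋q = upper-open y y∋r in q , q<r , inj₂ y∋q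
  ; disjoint        = λ where
      ((x∋q , _) , inj₁ x∋q′) → disjoint x (x∋q , x∋q′)
      ((_ , y∋q) , inj₂ y∋q′) → disjoint y (y∋q , y∋q′)
  ; located         = loc
  }
  where
  below : ∀ q r → ∃[ s ] s < q × s < r
  below q r with ℚ.≤-total q r
  ... | inj₁ q≤r = q - 1ℚ , q-1<q q , ℚ.<-≤-trans (q-1<q q) q≤r
  ... | inj₂ r≤q = r - 1ℚ , ℚ.<-≤-trans (q-1<q r) r≤q , q-1<q r

  open-min : ∀ {q} → ∃[ r ] q < r × lower x r → ∃[ r ] q < r × lower y r →
             ∃[ r ] q < r × lower x r × lower y r
  open-min (r , q<r , x∋r) (s , q<s , y∋s) with ℚ.<-cmp r s
  ... | tri< r<s _ _    = r , q<r , x∋r , lower-closed y r<s y∋s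
  ... | tri≈ _ refl _   = r , q<r , x∋r , y∋s
  ... | tri> _ _ s<r    = s , q<s , lower-closed x s<r x∋r , y∋s

  loc : ∀ {q r} → q < r → (lower x q × lower y q) ⊎ (upper x r ⊎ upper y r)
  loc q<r with located x q<r | located y q<r
  ... | inj₁ x∋q | inj₁ y∋q = inj₁ (x∋q , y∋q)
  ... | inj₂ x∋r | _        = inj₂ (inj₁ x∋r)
  ... | inj₁ _   | inj₂ y∋r = inj₂ (inj₂ y∋r)

cube : ℚ → ℚ
cube q = q * q * q

private
  cube-mono-< : ∀ {s t} → 0ℚ ≤ s → s < t → cube s < cube t
  cube-mono-< {s} {t} 0≤s s<t = begin-strict
    s * s * s  ≤⟨ ℚ.*-monoʳ-≤-nonNeg s (ℚ.*-monoʳ-≤-nonNeg s s≤t) ⟩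
    t * s * s  ≤⟨ ℚ.*-monoʳ-≤-nonNeg s (ℚ.*-monoˡ-≤-nonNeg t s≤t) ⟩
    t * t * s  <⟨ ℚ.*-monoʳ-<-pos (t * t) s<t ⟩
    t * t * t  ∎
    where
    open ℚ.≤-Reasoning
    s≤t = ℚ.<⇒≤ s<t
    instance
      _ = nonNegative 0≤s
      pos-t = positive (ℚ.≤-<-trans 0≤s s<t)
      _ = ℚ.pos⇒nonNeg t
      _ = ℚ.pos*pos⇒pos t t

  1/n<8 : ∀ n .{{_ : ℕ.NonZero n}} → ℤ.1ℤ / n < cube (1ℚ + 1ℚ)
  1/n<8 (suc k) = ℚ.toℚᵘ-cancel-<
    (ℚᵘ.<-respˡ-≃ (ℚᵘ.≃-sym (ℚ.toℚᵘ-fromℚᵘ (ℚᵘ.mkℚᵘ ℤ.1ℤ k)))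
      (ℚᵘ.*<* (ℤ.+<+ (ℕ.s≤s (ℕ.≤-trans (ℕ.s≤s ℕ.z≤n) (ℕ.m≤n+m (7 ℕ.* suc k) k))))))

-- The real m^(-1/3): the nonnegative rationals r below it are those with
-- r³ < 1/m, the ones above it those with 1/m < r³.
infixl 9 _^-⅓
_^-⅓ : (m : ℕ) .{{_ : ℕ.NonZero m}} → ℝ
m ^-⅓ = record
  { lower           = λ q → ∃[ r ] 0ℚ ≤ r × q < r × cube r < 1/m
  ; upper           = λ q → ∃[ r ] 0ℚ ≤ r × r < q × 1/m < cube r
  ; lower-inhabited = 0ℚ - 1ℚ , 0ℚ , ℚ.≤-refl , q-1<q 0ℚ , 0<1/m
  ; upper-inhabited = 2ℚ + 1ℚ , 2ℚ , ℚ.nonNegative⁻¹ 2ℚ , q<q+1 2ℚ , 1/m<8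
  ; lower-closed    = λ q<r (s , 0≤s , r<s , p) → s , 0≤s , ℚ.<-trans q<r r<s , p
  ; upper-closed    = λ q<r (s , 0≤s , s<q , p) → s , 0≤s , ℚ.<-trans s<q q<r , p
  ; lower-open      = λ (s , 0≤s , q<s , p) →
      let t , q<t , t<s = ℚ.<-dense q<s in t , q<t , s , 0≤s , t<s , p
  ; upper-open      = λ (s , 0≤s , s<q , p) →
      let t , s<t , t<q = ℚ.<-dense s<q in t , t<q , s , 0≤s , s<t , p
  ; disjoint        = λ ((r , _ , q<r , r³<1/m) , (s , 0≤s , s<q , 1/m<s³)) →
      ℚ.<-asym (ℚ.<-trans 1/m<s³ (cube-mono-< 0≤s (ℚ.<-trans s<q q<r))) r³<1/m
  ; located         = loc
  }
  where
  1/m 2ℚ : ℚ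
  1/m = ℤ.1ℤ / m
  2ℚ  = 1ℚ + 1ℚ

  0<1/m : 0ℚ < 1/m
  0<1/m = ℚ.positive⁻¹ 1/m {{ℚ.normalize-pos 1 m}}

  1/m<8 : 1/m < cube 2ℚ
  1/m<8 = 1/n<8 m

  loc : ∀ {q r} → q < r →
        (∃[ s ] 0ℚ ≤ s × q < s × cube s < 1/m) ⊎ (∃[ s ] 0ℚ ≤ s × s < r × 1/m < cube s)
  loc q<r with ℚ.<-dense q<r
  ... | s , q<s , s<r with ℚ.<-dense s<r
  ... | t , s<t , t<r with 0ℚ ℚ.≤? s
  ... | no  0≰s = inj₁ (0ℚ , ℚ.≤-refl , ℚ.<-trans q<s (ℚ.≰⇒> 0≰s) , 0<1/m)
  ... | yes 0≤s with cube s ℚ.<? 1/m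
  ... | yes p = inj₁ (s , 0≤s , q<s , p)
  ... | no ¬p = inj₂ (t , ℚ.<⇒≤ (ℚ.≤-<-trans 0≤s s<t) , t<r ,
                      ℚ.≤-<-trans (ℚ.≮⇒≥ ¬p) (cube-mono-< 0≤s s<t))

record Graph (n : ℕ) : Set where
  field
    adj         : Fin n → Fin n → Bool
    symmetric   : ∀ u v → adj u v ≡ adj v u
    irreflexive : ∀ v → adj v v ≡ false

open Graph public

pairs : ∀ n → List (Fin n × Fin n)
pairs n = filter (λ (u , v) → u Fin.<? v) (cartesianProduct (allFin n) (allFin n))

∣E∣ : ∀ {n} → Graph n → ℕ
∣E∣ G = length (filter (λ (u , v) → adj G u v 𝔹.≟ true) (pairs _))

-- The number of edge additions and removals that turn G into H.
dist : ∀ {n} → Graph n → Graph n → ℕ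
dist G H = length (filter (λ (u , v) → ¬? (adj G u v 𝔹.≟ adj H u v)) (pairs _))

TriangleFree : ∀ {n} → Graph n → Set
TriangleFree G =
  ¬ (∃[ u ] ∃[ v ] ∃[ w ] adj G u v ≡ true × adj G v w ≡ true × adj G u w ≡ true)

-- ε|E| ≤ dist G H, divided by |E|.
FarFromTriangleFree : ∀ {n} → ℝ → (G : Graph n) .{{_ : ℕ.NonZero (∣E∣ G)}} → Set
FarFromTriangleFree ε G =
  ∀ H → TriangleFree H → ε ≤ℝ fromℚ (ℤ.+ dist G H / ∣E∣ G)

Bits : ℕ → Set
Bits = Vec Bool

-- A graph whose nodes carry unique identifiers of idBits bits and number
-- their incident edges locally ("ports"), in an arbitrary way.
record Network (n idBits : ℕ) : Set where
  field
    graph        : Graph n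
    ident        : Fin n → Bits idBits
    ident-unique : Injective _≡_ _≡_ ident
    deg          : Fin n → ℕ
    ports        : ∀ v → Fin (deg v) ↔ (∃[ w ] adj graph v w ≡ true)

  neighbour : (v : Fin n) → Fin (deg v) → Fin n
  neighbour v p = proj₁ (Inverse.to (ports v) p)

  -- The port of the neighbour at the other end of the same edge.
  reversePort : (v : Fin n) (p : Fin (deg v)) → Fin (deg (neighbour v p))
  reversePort v p =
    let w , vw = Inverse.to (ports v) p
    in Inverse.from (ports w) (v , trans (symmetric graph w v) vw)

-- The program run by every node.  A node of degree d initially knows only d,
-- its own identifier, and a private string of coins uniformly random bits (and
-- whatever parameters, such as n and ε, the program itself was chosen for).
-- In each round it sends a message of bandwidth bits through each port and
-- then updates its state according to the messages received.
record Algorithm (idBits bandwidth : ℕ) : Set₁ where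
  field
    coins   : ℕ
    State   : (d : ℕ) → Set
    init    : ∀ d → Bits idBits → Bits coins → State d
    send    : ∀ {d} → State d → Fin d → Bits bandwidth
    receive : ∀ {d} → State d → (Fin d → Bits bandwidth) → State d
    accept  : ∀ {d} → State d → Bool

module Execution {n idBits bandwidth : ℕ}
                 (A : Algorithm idBits bandwidth) (N : Network n idBits) where
  open Algorithm A
  open Network N

  state : Vec (Bits coins) n → (rounds : ℕ) → (v : Fin n) → State (deg v)
  state ω zero    v = init (deg v) (ident v) (lookup ω v)
  state ω (suc t) v =
    receive (state ω t v) λ p → send (state ω t (neighbour v p)) (reversePort v p)

  accepts : (rounds : ℕ) → Vec (Bits coins) n → Fin n → Bool
  accepts rounds ω v = accept (state ω rounds v)

vectors : ∀ {A : Set} → List A → ∀ n → List (Vec A n)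
vectors xs zero    = [ [] ]
vectors xs (suc n) = cartesianProductWith _∷_ xs (vectors xs n)

outcomes : ∀ k n → List (Vec (Bits k) n)
outcomes k n = vectors (vectors (true ∷ false ∷ []) k) n

-- favourable / total ≥ 2/3, with denominators cleared.
Pr≥⅔ : ∀ {k n} {P : Pred (Vec (Bits k) n) 0ℓ} → Decidable P → Set
Pr≥⅔ {k} {n} P? = 2 ℕ.* length (outcomes k n) ℕ.≤ 3 ℕ.* length (filter P? (outcomes k n))

module _ {n idBits bandwidth : ℕ}
         (A : Algorithm idBits bandwidth) (rounds : ℕ) (N : Network n idBits) where
  open Algorithm A using (coins)
  open Execution A N using (accepts)

  AllAccept SomeRejects : Pred (Vec (Bits coins) n) 0ℓ
  AllAccept   ω = ∀ v → accepts rounds ω v ≡ true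
  SomeRejects ω = ∃[ v ] accepts rounds ω v ≡ false

  allAccept? : Decidable AllAccept
  allAccept? ω = Fin.all? λ v → accepts rounds ω v 𝔹.≟ true

  someRejects? : Decidable SomeRejects
  someRejects? ω = Fin.any? λ v → accepts rounds ω v 𝔹.≟ false

  TestsTriangleFreeness : (ε : ℝ) .{{_ : ℕ.NonZero (∣E∣ (Network.graph N))}} → Set
  TestsTriangleFreeness ε =
    (TriangleFree (Network.graph N) → Pr≥⅔ allAccept?) ×
    (FarFromTriangleFree ε (Network.graph N) → Pr≥⅔ someRejects?)

{-# OPTIONS --safe #-}
module Submission where

-- In two rounds every node v learns the identifiers of its neighbours and then sends those of 16
-- random neighbours over each edge; a node that receives the identifier of one of its own
-- neighbours has found a triangle.  Call an edge vw good if it lies in a triangle.  If v has g(v)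
-- good edges, each of its samples succeeds with probability about g(v)/d(v), all independently, and
-- ∏ (1 - pᵢ) ≤ 1 / (1 + ∑ pᵢ), so it remains to bound S = ∑ g(v)/d(v) from below.
-- Removing all good edges destroys all triangles, so there are M ≥ εm of them.  If M ≥ n then S ≥ 2,
-- since d(v) ≤ n.  If M ≥ m^(2/3), sum over the 2M ordered good pairs (v , w) the inequality
-- 1 ≤ d(v) d(w) / D² + D / d(v) + D / d(w) for D = 2M: the first term contributes at most
-- (2m)² / D² ≤ M, the others 2DS, so S ≥ 1/4.

open import Defs
open import Axiom.UniquenessOfIdentityProofs using (module Decidable⇒UIP)
open import Data.Bool using (Bool; true; false; not; _∧_)
import Data.Bool.Properties as 𝔹
open import Data.Fin as Fin using (Fin; zero; suc; toℕ)
import Data.Fin.Properties as Fin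
import Data.Integer as ℤ
import Data.Integer.Properties as ℤ
open import Data.List as List
  using (List; []; _∷_; map; _++_; length; filter; allFin; cartesianProduct; cartesianProductWith)
open import Data.List.Properties using (map-tabulate; filter-all)
open import Data.List.Relation.Unary.All using (universal)
open import Data.Nat as ℕ hiding (_/_)
open import Data.Nat.DivMod
  using (_mod_; m%n<n; m%n≤n; [m+n]%n≡m%n; m<n⇒m%n≡m; m≡m%n+[m/n]*n; m/n*n≤m; m≥n⇒m/n>0)
open import Data.Nat.Logarithm using (⌈log₂_⌉)
open import Data.Nat.Properties
open import Data.Nat.Tactic.RingSolver using (solve-∀)
open import Data.Product using (∃-syntax; Σ-syntax; _×_; _,_; proj₁; proj₂)
open import Data.Rational as ℚ using (_/_; 0ℚ; 1ℚ)
import Data.Rational.Properties as ℚ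
import Data.Rational.Unnormalised as ℚᵘ
import Data.Rational.Unnormalised.Properties as ℚᵘ
open import Data.Sum using (_⊎_; inj₁; inj₂)
open import Data.Vec as Vec using (Vec; []; _∷_; lookup; take; drop; concat; replicate)
open import Data.Vec.Properties using (take++drop≡id; ++-injective; lookup-map; ≡-dec)
open import Function using (_∘_)
open import Function.Bundles using (_↔_; module Inverse)
open import Level using (0ℓ)
open import Relation.Binary using (tri<; tri≈; tri>)
open import Relation.Binary.PropositionalEquality
open import Relation.Nullary using (¬_; Dec; yes; no; does; ¬?; contradiction; _×-dec_)
open import Relation.Nullary.Decidable using (dec-true; dec-false; does-≡; map′)
open import Relation.Unary using (Pred; Decidable)

private
  variable
    A B C : Set
    P : Pred A 0ℓ

-- Finite sums

∑ : List A → (A → ℕ) → ℕ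
∑ []       f = 0
∑ (x ∷ xs) f = f x + ∑ xs f

infix 5 ∑
syntax ∑ xs (λ x → e) = ∑[ x ← xs ] e

𝟙 : Bool → ℕ
𝟙 false = 0
𝟙 true  = 1

𝟙-not : ∀ b → 𝟙 b + 𝟙 (not b) ≡ 1
𝟙-not false = refl
𝟙-not true  = refl

∑-cong : ∀ (xs : List A) {f g : A → ℕ} → (∀ x → f x ≡ g x) → ∑ xs f ≡ ∑ xs g
∑-cong []       f≗g = refl
∑-cong (x ∷ xs) f≗g = cong₂ _+_ (f≗g x) (∑-cong xs f≗g)

∑-mono : ∀ (xs : List A) {f g : A → ℕ} → (∀ x → f x ≤ g x) → ∑ xs f ≤ ∑ xs g
∑-mono []       f≤g = z≤n
∑-mono (x ∷ xs) f≤g = +-mono-≤ (f≤g x) (∑-mono xs f≤g)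

∑-const : ∀ (xs : List A) c → (∑[ _ ← xs ] c) ≡ length xs * c
∑-const []       c = refl
∑-const (x ∷ xs) c = cong (c +_) (∑-const xs c)

∑-+ : ∀ (xs : List A) (f g : A → ℕ) → (∑[ x ← xs ] f x + g x) ≡ ∑ xs f + ∑ xs g
∑-+ []       f g = refl
∑-+ (x ∷ xs) f g rewrite ∑-+ xs f g = interchange (f x) (g x) (∑ xs f) (∑ xs g)
  where
  interchange : ∀ a b c d → a + b + (c + d) ≡ a + c + (b + d)
  interchange = solve-∀

∑-*ˡ : ∀ (xs : List A) c (f : A → ℕ) → (∑[ x ← xs ] c * f x) ≡ c * ∑ xs f
∑-*ˡ []       c f = sym (*-zeroʳ c)
∑-*ˡ (x ∷ xs) c f rewrite ∑-*ˡ xs c f = sym (*-distribˡ-+ c (f x) (∑ xs f))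

∑-*ʳ : ∀ (xs : List A) c (f : A → ℕ) → (∑[ x ← xs ] f x * c) ≡ ∑ xs f * c
∑-*ʳ []       c f = refl
∑-*ʳ (x ∷ xs) c f rewrite ∑-*ʳ xs c f = sym (*-distribʳ-+ c (f x) (∑ xs f))

∑-++ : ∀ (xs ys : List A) f → ∑ (xs ++ ys) f ≡ ∑ xs f + ∑ ys f
∑-++ []       ys f = refl
∑-++ (x ∷ xs) ys f rewrite ∑-++ xs ys f = sym (+-assoc (f x) (∑ xs f) (∑ ys f))

∑-map : ∀ (g : A → B) xs f → ∑ (map g xs) f ≡ ∑ xs (f ∘ g)
∑-map g []       f = refl
∑-map g (x ∷ xs) f = cong (f (g x) +_) (∑-map g xs f)

∑-comm : ∀ (xs : List A) (ys : List B) (f : A → B → ℕ) →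
         (∑[ x ← xs ] ∑[ y ← ys ] f x y) ≡ (∑[ y ← ys ] ∑[ x ← xs ] f x y)
∑-comm []       ys f = sym (trans (∑-const ys 0) (*-zeroʳ (length ys)))
∑-comm (x ∷ xs) ys f rewrite ∑-comm xs ys f = sym (∑-+ ys (f x) (λ y → ∑[ x ← xs ] f x y))

∑-cartesianProductWith : ∀ (g : A → B → C) xs ys f →
  ∑ (cartesianProductWith g xs ys) f ≡ (∑[ x ← xs ] ∑[ y ← ys ] f (g x y))
∑-cartesianProductWith g []       ys f = refl
∑-cartesianProductWith g (x ∷ xs) ys f
  rewrite ∑-++ (map (g x) ys) (cartesianProductWith g xs ys) f
        | ∑-map (g x) ys f
        | ∑-cartesianProductWith g xs ys f = refl

∑-filter : (P? : Decidable P) → ∀ xs f →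
           ∑ (filter P? xs) f ≡ (∑[ x ← xs ] 𝟙 (does (P? x)) * f x)
∑-filter P? []       f = refl
∑-filter P? (x ∷ xs) f with does (P? x)
... | true  = cong₂ _+_ (sym (+-identityʳ (f x))) (∑-filter P? xs f)
... | false = ∑-filter P? xs f

length-filter-∑ : (P? : Decidable P) → ∀ xs →
                  length (filter P? xs) ≡ (∑[ x ← xs ] 𝟙 (does (P? x)))
length-filter-∑ P? []       = refl
length-filter-∑ P? (x ∷ xs) with does (P? x)
... | true  = cong suc (length-filter-∑ P? xs)
... | false = length-filter-∑ P? xs

∑-allFin-suc : ∀ n (f : Fin (suc n) → ℕ) →
               ∑ (allFin (suc n)) f ≡ f zero + (∑[ i ← allFin n ] f (suc i))
∑-allFin-suc n f = cong (f zero +_) (begin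
  ∑ (List.tabulate suc) f       ≡⟨ cong (λ is → ∑ is f) (map-tabulate (λ i → i) suc) ⟨
  ∑ (map suc (allFin n)) f           ≡⟨ ∑-map suc (allFin n) f ⟩
  (∑[ i ← allFin n ] f (suc i))      ∎)
  where open ≡-Reasoning

∑-allFin-1 : ∀ n → (∑[ _ ← allFin n ] 1) ≡ n
∑-allFin-1 zero    = refl
∑-allFin-1 (suc n) = trans (∑-allFin-suc n (λ _ → 1)) (cong suc (∑-allFin-1 n))

∑-none : ∀ {n} (p : Fin n → Bool) → (∀ j → p j ≡ false) → (∑[ j ← allFin n ] 𝟙 (p j)) ≡ 0
∑-none {n} p ¬p = begin
  (∑[ j ← allFin n ] 𝟙 (p j))  ≡⟨ ∑-cong (allFin n) (λ j → cong 𝟙 (¬p j)) ⟩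
  (∑[ j ← allFin n ] 0)        ≡⟨ ∑-const (allFin n) 0 ⟩
  length (allFin n) * 0        ≡⟨ *-zeroʳ (length (allFin n)) ⟩
  0                            ∎
  where open ≡-Reasoning

∑-unique : ∀ {n} (p : Fin n → Bool) i → p i ≡ true → (∀ j → p j ≡ true → j ≡ i) →
           (∑[ j ← allFin n ] 𝟙 (p j)) ≡ 1
∑-unique {suc n} p zero pi uniq =
  trans (∑-allFin-suc n (𝟙 ∘ p))
    (cong₂ _+_ (cong 𝟙 pi)
      (∑-none (p ∘ suc) λ j → 𝔹.¬-not λ pj → contradiction (uniq (suc j) pj) λ ()))
∑-unique {suc n} p (suc i) pi uniq =
  trans (∑-allFin-suc n (𝟙 ∘ p))
    (cong₂ _+_ (cong 𝟙 (𝔹.¬-not λ p0 → contradiction (uniq zero p0) λ ()))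
      (∑-unique (p ∘ suc) i pi λ j pj → Fin.suc-injective (uniq (suc j) pj)))

-- By trichotomy the ordered pairs split into those with `u < v` and those with `v < u`; symmetry
-- and an exchange of the sums make the two halves equal.
∑∑-pairs : ∀ {n} {P : Pred (Fin n × Fin n) 0ℓ} (P? : Decidable P) →
           (∀ u v → does (P? (u , v)) ≡ does (P? (v , u))) →
           (∀ v → does (P? (v , v)) ≡ false) →
           (∑[ u ← allFin n ] ∑[ v ← allFin n ] 𝟙 (does (P? (u , v)))) ≡
           2 * length (filter P? (pairs n))
∑∑-pairs {n} P? P-sym P-irrefl = begin
  (∑[ u ← V ] ∑[ v ← V ] p u v)
    ≡⟨ ∑-cong V (λ u → ∑-cong V (split u)) ⟩
  (∑[ u ← V ] ∑[ v ← V ] lt u v * p u v + lt v u * p u v)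
    ≡⟨ ∑-cong V (λ u → ∑-+ V _ _) ⟩
  (∑[ u ← V ] (∑[ v ← V ] lt u v * p u v) + (∑[ v ← V ] lt v u * p u v))
    ≡⟨ ∑-+ V _ _ ⟩
  L + (∑[ u ← V ] ∑[ v ← V ] lt v u * p u v)
    ≡⟨ cong (L +_) (∑-comm V V _) ⟩
  L + (∑[ v ← V ] ∑[ u ← V ] lt v u * p u v)
    ≡⟨ cong (L +_) (∑-cong V λ v → ∑-cong V λ u → cong (λ b → lt v u * 𝟙 b) (P-sym u v)) ⟩
  L + L
    ≡⟨ cong (L +_) (+-identityʳ L) ⟨
  2 * L
    ≡⟨ cong (2 *_) L≡ ⟨
  2 * length (filter P? (pairs n)) ∎
  where
  open ≡-Reasoning
  V = allFin n

  p lt : Fin n → Fin n → ℕ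
  p u v  = 𝟙 (does (P? (u , v)))
  lt u v = 𝟙 (does (u Fin.<? v))

  L : ℕ
  L = ∑[ u ← V ] ∑[ v ← V ] lt u v * p u v

  split : ∀ u v → p u v ≡ lt u v * p u v + lt v u * p u v
  split u v with Fin.<-cmp u v
  ... | tri< u<v _ v≮u rewrite dec-true (u Fin.<? v) u<v | dec-false (v Fin.<? u) v≮u =
    sym (trans (+-identityʳ _) (+-identityʳ _))
  ... | tri> u≮v _ v<u rewrite dec-false (u Fin.<? v) u≮v | dec-true (v Fin.<? u) v<u =
    sym (+-identityʳ _)
  ... | tri≈ u≮v refl _ rewrite dec-false (u Fin.<? u) u≮v = cong 𝟙 (P-irrefl u)

  L≡ : length (filter P? (pairs n)) ≡ L
  L≡ = begin
    length (filter P? (pairs n))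
      ≡⟨ length-filter-∑ P? (pairs n) ⟩
    (∑[ e ← pairs n ] 𝟙 (does (P? e)))
      ≡⟨ ∑-filter (λ (u , v) → u Fin.<? v) (cartesianProduct V V) _ ⟩
    (∑[ e ← cartesianProduct V V ] lt (proj₁ e) (proj₂ e) * 𝟙 (does (P? e)))
      ≡⟨ ∑-cartesianProductWith _,_ V V _ ⟩
    L ∎

-- Independent choices

∏ : ∀ n → (Fin n → ℕ) → ℕ
∏ zero    f = 1
∏ (suc n) f = f zero * ∏ n (f ∘ suc)

∏-cong : ∀ n {f g : Fin n → ℕ} → (∀ i → f i ≡ g i) → ∏ n f ≡ ∏ n g
∏-cong zero    f≗g = refl
∏-cong (suc n) f≗g = cong₂ _*_ (f≗g zero) (∏-cong n (f≗g ∘ suc))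

∏-const : ∀ n c → ∏ n (λ _ → c) ≡ c ^ n
∏-const zero    c = refl
∏-const (suc n) c = cong (c *_) (∏-const n c)

∏-1 : ∀ n (f : Fin n → ℕ) → (∀ i → f i ≡ 1) → ∏ n f ≡ 1
∏-1 n f f≡1 = trans (∏-cong n f≡1) (trans (∏-const n 1) (^-zeroˡ n))

-- Independence of the coordinates of a uniform vector, with counts in place of expectations; at
-- bottom it is the distributive law.
∑-vectors : ∀ (xs : List A) n (F : Fin n → A → ℕ) →
            (∑[ v ← vectors xs n ] ∏ n (λ i → F i (lookup v i))) ≡ ∏ n (λ i → ∑ xs (F i))
∑-vectors xs zero    F = refl
∑-vectors xs (suc n) F = begin
  (∑[ v ← vectors xs (suc n) ] ∏ (suc n) (λ i → F i (lookup v i)))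
    ≡⟨ ∑-cartesianProductWith _∷_ xs (vectors xs n) _ ⟩
  (∑[ x ← xs ] ∑[ v ← vectors xs n ] F zero x * ∏ n (λ i → F (suc i) (lookup v i)))
    ≡⟨ ∑-cong xs (λ x → trans (∑-*ˡ (vectors xs n) (F zero x) _)
                              (cong (F zero x *_) (∑-vectors xs n (F ∘ suc)))) ⟩
  (∑[ x ← xs ] F zero x * ∏ n (λ i → ∑ xs (F (suc i))))
    ≡⟨ ∑-*ʳ xs _ (F zero) ⟩
  ∏ (suc n) (λ i → ∑ xs (F i)) ∎
  where open ≡-Reasoning

∑-vectors-++ : ∀ (xs : List A) m {n} (f : Vec A (m + n) → ℕ) →
  ∑ (vectors xs (m + n)) f ≡ (∑[ v ← vectors xs m ] ∑[ w ← vectors xs n ] f (v Vec.++ w))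
∑-vectors-++ xs zero    {n} f = sym (+-identityʳ (∑ (vectors xs n) f))
∑-vectors-++ xs (suc m) {n} f = begin
  ∑ (vectors xs (suc m + n)) f
    ≡⟨ ∑-cartesianProductWith _∷_ xs (vectors xs (m + n)) f ⟩
  (∑[ x ← xs ] ∑[ u ← vectors xs (m + n) ] f (x ∷ u))
    ≡⟨ ∑-cong xs (λ x → ∑-vectors-++ xs m (f ∘ (x ∷_))) ⟩
  (∑[ x ← xs ] ∑[ v ← vectors xs m ] ∑[ w ← vectors xs n ] f (x ∷ v Vec.++ w))
    ≡⟨ ∑-cartesianProductWith _∷_ xs (vectors xs m) _ ⟨
  (∑[ v ← vectors xs (suc m) ] ∑[ w ← vectors xs n ] f (v Vec.++ w)) ∎
  where open ≡-Reasoning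

length-∑ : ∀ (xs : List A) → length xs ≡ (∑[ _ ← xs ] 1)
length-∑ xs = sym (trans (∑-const xs 1) (*-identityʳ (length xs)))

length-vectors : ∀ (xs : List A) n → length (vectors xs n) ≡ length xs ^ n
length-vectors xs n = begin
  length (vectors xs n)                                    ≡⟨ length-∑ (vectors xs n) ⟩
  (∑[ _ ← vectors xs n ] 1)
    ≡⟨ ∑-cong (vectors xs n) (λ v → sym (∏-1 n _ λ i → refl)) ⟩
  (∑[ v ← vectors xs n ] ∏ n (λ _ → 1))                    ≡⟨ ∑-vectors xs n (λ _ _ → 1) ⟩
  ∏ n (λ _ → ∑[ _ ← xs ] 1)                                ≡⟨ ∏-const n _ ⟩
  (∑[ _ ← xs ] 1) ^ n                                      ≡⟨ cong (_^ n) (length-∑ xs) ⟨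
  length xs ^ n                                            ∎
  where open ≡-Reasoning

-- Serves both to split a coin string into samples and to parse a message into identifiers.
chunk : ∀ r {k} → Vec A (r * k) → Vec (Vec A k) r
chunk zero        xs = []
chunk (suc r) {k} xs = take k xs ∷ chunk r (drop k xs)

chunk-++ : ∀ r {k} (xs : Vec A k) (ys : Vec A (r * k)) →
           chunk (suc r) (xs Vec.++ ys) ≡ xs ∷ chunk r ys
chunk-++ r {k} xs ys =
  let take≡ , drop≡ = ++-injective (take k (xs Vec.++ ys)) xs (take++drop≡id k (xs Vec.++ ys))
  in cong₂ _∷_ take≡ (cong (chunk r) drop≡)

chunk-concat : ∀ {r k} (xss : Vec (Vec A k) r) → chunk r (concat xss) ≡ xss
chunk-concat []                   = refl
chunk-concat {r = suc r} (xs ∷ xss) =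
  trans (chunk-++ r xs (concat xss)) (cong (xs ∷_) (chunk-concat xss))

-- Consecutive blocks of one coin string behave as `r` independent samples.
∑-chunk : ∀ (xs : List A) r {k} (F : Vec A k → ℕ) →
  (∑[ v ← vectors xs (r * k) ] ∏ r (λ j → F (lookup (chunk r v) j))) ≡ ∑ (vectors xs k) F ^ r
∑-chunk xs zero        F = refl
∑-chunk xs (suc r) {k} F = begin
  (∑[ v ← vectors xs (k + r * k) ] φ (chunk (suc r) v))
    ≡⟨ ∑-vectors-++ xs k _ ⟩
  (∑[ v ← vectors xs k ] ∑[ w ← vectors xs (r * k) ] φ (chunk (suc r) (v Vec.++ w)))
    ≡⟨ ∑-cong (vectors xs k) (λ v → ∑-cong (vectors xs (r * k)) λ w → cong φ (chunk-++ r v w)) ⟩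
  (∑[ v ← vectors xs k ] ∑[ w ← vectors xs (r * k) ] φ (v ∷ chunk r w))
    ≡⟨ ∑-cong (vectors xs k) (λ v → trans (∑-*ˡ (vectors xs (r * k)) (F v) _)
                                          (cong (F v *_) (∑-chunk xs r F))) ⟩
  (∑[ v ← vectors xs k ] F v * ∑ (vectors xs k) F ^ r)
    ≡⟨ ∑-*ʳ (vectors xs k) _ F ⟩
  ∑ (vectors xs k) F ^ suc r ∎
  where
  open ≡-Reasoning
  φ : ∀ {r} → Vec (Vec _ k) r → ℕ
  φ {r} v = ∏ r (λ j → F (lookup v j))

-- Divided by powers of Q, the next four lemmas say ∏ (1 - pᵢ) ≤ 1 / (1 + ∑ pᵢ), where pᵢ = sᵢ / Q.

failure-combine : ∀ Q .{{_ : NonZero Q}} a b {s t A B} →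
  a * (Q + s) ≤ Q * A → b * (Q + t) ≤ Q * B → a * b * (Q + (s + t)) ≤ Q * (A * B)
failure-combine Q a b {s} {t} {A} {B} p q = *-cancelˡ-≤ Q (begin
  -- This is `1 + x + y ≤ (1 + x) * (1 + y)` for `x = s / Q` and `y = t / Q`.
  Q * (a * b * (Q + (s + t)))                  ≤⟨ m≤m+n _ (a * b * (s * t)) ⟩
  Q * (a * b * (Q + (s + t))) + a * b * (s * t) ≡⟨ e₁ Q a b s t ⟩
  a * (Q + s) * (b * (Q + t))                  ≤⟨ *-mono-≤ p q ⟩
  Q * A * (Q * B)                              ≡⟨ e₂ Q A B ⟩
  Q * (Q * (A * B))                            ∎)
  where
  open ≤-Reasoning
  e₁ : ∀ Q a b s t → Q * (a * b * (Q + (s + t))) + a * b * (s * t) ≡ a * (Q + s) * (b * (Q + t))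
  e₁ = solve-∀
  e₂ : ∀ Q A B → Q * A * (Q * B) ≡ Q * (Q * (A * B))
  e₂ = solve-∀

failure-once : ∀ {Q} f s → f + s ≡ Q → f * (Q + s) ≤ Q * Q
failure-once f s refl = begin
  -- This is `(1 - p) * (1 + p) ≤ 1` for `p = s / Q`.
  f * (f + s + s)          ≤⟨ m≤m+n _ (s * s) ⟩
  f * (f + s + s) + s * s  ≡⟨ e f s ⟩
  (f + s) * (f + s)        ∎
  where
  open ≤-Reasoning
  e : ∀ f s → f * (f + s + s) + s * s ≡ (f + s) * (f + s)
  e = solve-∀

failure-^ : ∀ Q .{{_ : NonZero Q}} {f s} r → f + s ≡ Q → f ^ r * (Q + r * s) ≤ Q * Q ^ r
failure-^ Q zero    eq = ≤-reflexive (e Q)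
  where
  e : ∀ Q → 1 * (Q + 0) ≡ Q * 1
  e = solve-∀
failure-^ Q {f} {s} (suc r) eq = failure-combine Q f (f ^ r) (failure-once f s eq) (failure-^ Q r eq)

failure-∏ : ∀ Q .{{_ : NonZero Q}} {A} n (a t : Fin n → ℕ) →
            (∀ i → a i * (Q + t i) ≤ Q * A) → ∏ n a * (Q + ∑ (allFin n) t) ≤ Q * A ^ n
failure-∏ Q zero    a t p = ≤-reflexive (e Q)
  where
  e : ∀ Q → 1 * (Q + 0) ≡ Q * 1
  e = solve-∀
failure-∏ Q (suc n) a t p rewrite ∑-allFin-suc n t =
  failure-combine Q (a zero) _ (p zero) (failure-∏ Q n (a ∘ suc) (t ∘ suc) (p ∘ suc))

-- Sampling a port from random bits

n≤2^n : ∀ n → n ≤ 2 ^ n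
n≤2^n zero    = z≤n
n≤2^n (suc n) = begin
  suc n          ≤⟨ +-mono-≤ (m^n>0 2 n) (n≤2^n n) ⟩
  2 ^ n + 2 ^ n  ≡⟨ cong (2 ^ n +_) (+-identityʳ (2 ^ n)) ⟨
  2 ^ suc n      ∎
  where open ≤-Reasoning

bits : ∀ k → List (Bits k)
bits = vectors (true ∷ false ∷ [])

-- `true` is the digit 0 because `bits` lists `true` first: along that list `val` then runs through
-- 0, 1, 2, ... in increasing order.
val : ∀ {k} → Bits k → ℕ
val         []          = 0
val         (true  ∷ x) = val x
val {suc k} (false ∷ x) = 2 ^ k + val x

range : ℕ → (ℕ → ℕ) → ℕ
range N F = ∑[ i ← allFin N ] F (toℕ i)

range-+ : ∀ M N F → range (M + N) F ≡ range M F + range N (F ∘ (M +_))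
range-+ zero    N F = refl
range-+ (suc M) N F = begin
  range (suc M + N) F                                             ≡⟨ ∑-allFin-suc (M + N) _ ⟩
  F 0 + range (M + N) (F ∘ suc)
    ≡⟨ cong (F 0 +_) (range-+ M N (F ∘ suc)) ⟩
  F 0 + (range M (F ∘ suc) + range N (F ∘ (suc M +_)))            ≡⟨ +-assoc (F 0) _ _ ⟨
  F 0 + range M (F ∘ suc) + range N (F ∘ (suc M +_))
    ≡⟨ cong (_+ range N (F ∘ (suc M +_))) (∑-allFin-suc M (F ∘ toℕ)) ⟨
  range (suc M) F + range N (F ∘ (suc M +_))                      ∎
  where open ≡-Reasoning

range-mono : ∀ {M N} F → M ≤ N → range M F ≤ range N F
range-mono {M} {N} F M≤N = begin
  range M F                                ≤⟨ m≤m+n _ _ ⟩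
  range M F + range (N ∸ M) (F ∘ (M +_))   ≡⟨ range-+ M (N ∸ M) F ⟨
  range (M + (N ∸ M)) F                    ≡⟨ cong (λ K → range K F) (m+[n∸m]≡n M≤N) ⟩
  range N F                                ∎
  where open ≤-Reasoning

range-periodic : ∀ d F → (∀ k → F (d + k) ≡ F k) → ∀ q → range (q * d) F ≡ q * range d F
range-periodic d F per zero    = refl
range-periodic d F per (suc q) = begin
  range (d + q * d) F                        ≡⟨ range-+ d (q * d) F ⟩
  range d F + range (q * d) (F ∘ (d +_))
    ≡⟨ cong (range d F +_) (∑-cong (allFin (q * d)) (per ∘ toℕ)) ⟩
  range d F + range (q * d) F                ≡⟨ cong (range d F +_) (range-periodic d F per q) ⟩
  range d F + q * range d F                  ∎
  where open ≡-Reasoning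

∑-val : ∀ k F → (∑[ x ← bits k ] F (val x)) ≡ range (2 ^ k) F
∑-val zero    F = refl
∑-val (suc k) F = begin
  (∑[ x ← bits (suc k) ] F (val x))
    ≡⟨ ∑-cartesianProductWith _∷_ (true ∷ false ∷ []) (bits k) _ ⟩
  (∑[ x ← bits k ] F (val x)) + ((∑[ x ← bits k ] F (2 ^ k + val x)) + 0)
    ≡⟨ cong₂ (λ a b → a + (b + 0)) (∑-val k F) (∑-val k (F ∘ (2 ^ k +_))) ⟩
  range (2 ^ k) F + (range (2 ^ k) (F ∘ (2 ^ k +_)) + 0)
    ≡⟨ cong (range (2 ^ k) F +_) (+-identityʳ _) ⟩
  range (2 ^ k) F + range (2 ^ k) (F ∘ (2 ^ k +_))
    ≡⟨ range-+ (2 ^ k) (2 ^ k) F ⟨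
  range (2 ^ k + 2 ^ k) F
    ≡⟨ cong (λ N → range (2 ^ k + N) F) (+-identityʳ (2 ^ k)) ⟨
  range (2 ^ suc k) F ∎
  where open ≡-Reasoning

-- The port in the argument only witnesses that there is one.
pick : ∀ {d k} → Fin d → Bits k → Fin d
pick {suc d} _ x = val x mod suc d

pick-irrelevant : ∀ {d k} (p p′ : Fin d) (x : Bits k) → pick p x ≡ pick p′ x
pick-irrelevant {suc d} _ _ _ = refl

-- Defined for `d = 0` as well, where there is no port to pick, so that the samples of an isolated
-- node can be counted; they all fail.
hits : ∀ {d k} → (Fin d → Bool) → Bits k → Bool
hits {zero}  g x = false
hits {suc d} g x = g (pick zero x)

hits-pick : ∀ {d k} (g : Fin d → Bool) (x : Bits k) → hits g x ≡ true → ∃[ p ] g (pick p x) ≡ true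
hits-pick {suc d} g x eq = zero , eq

-- N / d, with the junk value 0 at d = 0.
quot : ℕ → ℕ → ℕ
quot N zero    = 0
quot N (suc d) = N ℕ./ suc d

-- Rounding down loses at most half: the remainder is at most `d`, and the quotient is at least 1.
quot-lower : ∀ N d .{{_ : NonZero d}} → d ≤ N → N ≤ 2 * (quot N d * d)
quot-lower N d@(suc _) d≤N = begin
  N                    ≡⟨ m≡m%n+[m/n]*n N d ⟩
  N % d + q * d        ≤⟨ +-monoˡ-≤ (q * d) (m%n≤n N d) ⟩
  d + q * d            ≤⟨ +-monoˡ-≤ (q * d) (m≤n*m d q {{>-nonZero (m≥n⇒m/n>0 d≤N)}}) ⟩
  q * d + q * d        ≡⟨ cong (q * d +_) (+-identityʳ (q * d)) ⟨
  2 * (q * d)          ∎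
  where
  open ≤-Reasoning
  q = N ℕ./ d

mod-periodic : ∀ d .{{_ : NonZero d}} k → (d + k) mod d ≡ k mod d
mod-periodic d k = Fin.toℕ-injective (begin
  toℕ ((d + k) mod d)  ≡⟨ Fin.toℕ-fromℕ< _ ⟩
  (d + k) % d          ≡⟨ cong (_% d) (+-comm d k) ⟩
  (k + d) % d          ≡⟨ [m+n]%n≡m%n k d ⟩
  k % d                ≡⟨ Fin.toℕ-fromℕ< _ ⟨
  toℕ (k mod d)        ∎)
  where open ≡-Reasoning

toℕ-mod : ∀ {d} .{{_ : NonZero d}} (i : Fin d) → toℕ i mod d ≡ i
toℕ-mod {d} i = Fin.toℕ-injective
  (trans (Fin.toℕ-fromℕ< (m%n<n (toℕ i) d)) (m<n⇒m%n≡m (Fin.toℕ<n i)))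

-- Among the numbers below `2 ^ k` there are `quot (2 ^ k) d` complete periods modulo `d`, and each
-- meets every port once. The incomplete last period is dropped.
∑-hits : ∀ {d} k (g : Fin d → Bool) →
         quot (2 ^ k) d * (∑[ p ← allFin d ] 𝟙 (g p)) ≤ (∑[ x ← bits k ] 𝟙 (hits g x))
∑-hits {zero}    k g = z≤n
∑-hits d@{suc _} k g = begin
  q * (∑[ p ← allFin d ] 𝟙 (g p))  ≡⟨ cong (q *_) (∑-cong (allFin d) λ p → cong (𝟙 ∘ g) (toℕ-mod p)) ⟨
  q * range d F                    ≡⟨ range-periodic d F (λ k → cong (𝟙 ∘ g) (mod-periodic d k)) q ⟨
  range (q * d) F                  ≤⟨ range-mono F (m/n*n≤m (2 ^ k) d) ⟩
  range (2 ^ k) F                  ≡⟨ ∑-val k F ⟨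
  (∑[ x ← bits k ] 𝟙 (hits g x))   ∎
  where
  open ≤-Reasoning
  q = 2 ^ k ℕ./ d
  F : ℕ → ℕ
  F k = 𝟙 (g (k mod d))

-- Edges in triangles

does-true : ∀ {P : Set} (P? : Dec P) → does P? ≡ true → P
does-true (yes p) _ = p

∑-δ : ∀ {n} i (F : Fin n → ℕ) → (∑[ j ← allFin n ] 𝟙 (does (i Fin.≟ j)) * F j) ≡ F i
∑-δ {n} i F = begin
  (∑[ j ← allFin n ] 𝟙 (δ j) * F j)       ≡⟨ ∑-cong (allFin n) pointwise ⟩
  (∑[ j ← allFin n ] 𝟙 (δ j) * F i)       ≡⟨ ∑-*ʳ (allFin n) (F i) (𝟙 ∘ δ) ⟩
  (∑[ j ← allFin n ] 𝟙 (δ j)) * F i       ≡⟨ cong (_* F i) (∑-unique δ i (dec-true (i Fin.≟ i) refl)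
                                                (λ j δj → sym (does-true (i Fin.≟ j) δj))) ⟩
  1 * F i                                 ≡⟨ *-identityˡ (F i) ⟩
  F i                                     ∎
  where
  open ≡-Reasoning
  δ : Fin n → Bool
  δ j = does (i Fin.≟ j)
  pointwise : ∀ j → 𝟙 (δ j) * F j ≡ 𝟙 (δ j) * F i
  pointwise j with i Fin.≟ j
  ... | yes refl = refl
  ... | no  _    = refl

-- Double counting: `F` at a neighbour is expanded into a sum of Kronecker deltas over all vertices,
-- and after an exchange of the sums every neighbour has exactly one port.
∑-↔ : ∀ {d n} {a : Fin n → Bool} (φ : Fin d ↔ (∃[ w ] a w ≡ true)) (F : Fin n → ℕ) →
      (∑[ p ← allFin d ] F (proj₁ (Inverse.to φ p))) ≡ (∑[ w ← allFin n ] 𝟙 (a w) * F w)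
∑-↔ {d} {n} {a} φ F = begin
  (∑[ p ← allFin d ] F (nb p))
    ≡⟨ ∑-cong (allFin d) (λ p → ∑-δ (nb p) F) ⟨
  (∑[ p ← allFin d ] ∑[ w ← allFin n ] 𝟙 (does (nb p Fin.≟ w)) * F w)
    ≡⟨ ∑-comm (allFin d) (allFin n) _ ⟩
  (∑[ w ← allFin n ] ∑[ p ← allFin d ] 𝟙 (does (nb p Fin.≟ w)) * F w)
    ≡⟨ ∑-cong (allFin n) (λ w → trans (∑-*ʳ (allFin d) (F w) _) (cong (_* F w) (preimages w))) ⟩
  (∑[ w ← allFin n ] 𝟙 (a w) * F w) ∎
  where
  open ≡-Reasoning
  open Inverse φ
  nb : Fin d → Fin n
  nb = proj₁ ∘ to

  -- The bijection also returns a proof of adjacency; such proofs are equal since equality of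
  -- booleans is decidable.
  same : ∀ {u w} (au : a u ≡ true) (aw : a w ≡ true) → u ≡ w → (u , au) ≡ (w , aw)
  same au aw refl = cong (_ ,_) (Decidable⇒UIP.≡-irrelevant 𝔹._≟_ au aw)

  preimages : ∀ w → (∑[ p ← allFin d ] 𝟙 (does (nb p Fin.≟ w))) ≡ 𝟙 (a w)
  preimages w with a w in aw
  ... | false = ∑-none _ λ p → dec-false (nb p Fin.≟ w) λ { refl →
                  contradiction (trans (sym (proj₂ (to p))) aw) λ () }
  ... | true  = ∑-unique _ (from (w , aw))
                  (dec-true (nb (from (w , aw)) Fin.≟ w) (cong proj₁ (strictlyInverseˡ (w , aw))))
                  (λ p δp → trans (sym (strictlyInverseʳ p))
                    (cong from (same (proj₂ (to p)) aw (does-true (nb p Fin.≟ w) δp))))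

module _ {n} (G : Graph n) where

  InTriangle : Fin n → Fin n → Set
  InTriangle v w = adj G v w ≡ true × ∃[ u ] adj G v u ≡ true × adj G w u ≡ true

  inTriangle? : ∀ v w → Dec (InTriangle v w)
  inTriangle? v w =
    (adj G v w 𝔹.≟ true) ×-dec Fin.any? λ u → (adj G v u 𝔹.≟ true) ×-dec (adj G w u 𝔹.≟ true)

  inTriangle : Fin n → Fin n → Bool
  inTriangle v w = does (inTriangle? v w)

  InTriangle-sym : ∀ {v w} → InTriangle v w → InTriangle w v
  InTriangle-sym {v} {w} (vw , u , vu , wu) = trans (symmetric G w v) vw , u , wu , vu

  inTriangle-sym : ∀ v w → inTriangle v w ≡ inTriangle w v
  inTriangle-sym v w =
    does-≡ (inTriangle? v w) (map′ InTriangle-sym InTriangle-sym (inTriangle? w v))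

  inTriangle-adj : ∀ v w → inTriangle v w ≡ true → adj G v w ≡ true
  inTriangle-adj v w = proj₁ ∘ does-true (inTriangle? v w)

  -- Deletes all good edges at once. This need not be a cheapest repair, but farness applied to it
  -- bounds the number of good edges from below.
  withoutTriangles : Graph n
  withoutTriangles = record
    { adj         = λ v w → adj G v w ∧ not (inTriangle v w)
    ; symmetric   = λ v w → cong₂ (λ a b → a ∧ not b) (symmetric G v w) (inTriangle-sym v w)
    ; irreflexive = λ v → cong (_∧ not (inTriangle v v)) (irreflexive G v)
    }

  -- A surviving triangle would be one of `G`, so its edge `u v` would be good and hence deleted.
  withoutTriangles-triangleFree : TriangleFree withoutTriangles
  withoutTriangles-triangleFree (u , v , w , uv , vw , uw) =
    contradiction (dec-true (inTriangle? u v) (G-edge uv , w , G-edge uw , G-edge vw))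
                  (¬inTriangle (adj G u v) uv)
    where
    G-edge : ∀ {v w} → adj withoutTriangles v w ≡ true → adj G v w ≡ true
    G-edge {v} {w} e with adj G v w
    ... | true = refl
    ¬inTriangle : ∀ a {b} → a ∧ not b ≡ true → ¬ b ≡ true
    ¬inTriangle true {false} _ ()

  ∑-adj : (∑[ v ← allFin n ] ∑[ w ← allFin n ] 𝟙 (adj G v w)) ≡ 2 * ∣E∣ G
  ∑-adj = trans
    (∑-cong (allFin n) λ v → ∑-cong (allFin n) λ w → cong 𝟙 (sym (does-≟-true (adj G v w))))
    (∑∑-pairs (λ (u , v) → adj G u v 𝔹.≟ true)
      (λ u v → cong (λ b → does (b 𝔹.≟ true)) (symmetric G u v))
      (λ v → cong (λ b → does (b 𝔹.≟ true)) (irreflexive G v)))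
    where
    does-≟-true : ∀ b → does (b 𝔹.≟ true) ≡ b
    does-≟-true false = refl
    does-≟-true true  = refl

  -- Good pairs are edges, so the adjacencies of the two graphs differ exactly at the good pairs.
  ∑-inTriangle : (∑[ v ← allFin n ] ∑[ w ← allFin n ] 𝟙 (inTriangle v w)) ≡
                 2 * dist G withoutTriangles
  ∑-inTriangle = trans
    (∑-cong (allFin n) λ v → ∑-cong (allFin n) λ w → cong 𝟙 (sym (removed v w)))
    (∑∑-pairs (λ (u , v) → ¬? (adj G u v 𝔹.≟ adj withoutTriangles u v))
      (λ u v → trans (removed u v) (trans (inTriangle-sym u v) (sym (removed v u))))
      (λ v → trans (removed v v) (dec-false (inTriangle? v v)
        λ (vv , _) → contradiction (trans (sym vv) (irreflexive G v)) λ ())))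
    where
    differs : ∀ a b → (b ≡ true → a ≡ true) → does (¬? (a 𝔹.≟ (a ∧ not b))) ≡ b
    differs false false _   = refl
    differs false true  b⇒a = b⇒a refl
    differs true  false _   = refl
    differs true  true  _   = refl
    removed : ∀ u v → does (¬? (adj G u v 𝔹.≟ adj withoutTriangles u v)) ≡ inTriangle u v
    removed u v = differs (adj G u v) (inTriangle u v) (inTriangle-adj u v)

-- With q v ≈ Q / d v this is 1 ≤ x y + 1/x + 1/y for x = d v / D and y = d w / D, summed over
-- all pairs in t.
module _ {n} (t : Fin n → Fin n → Bool) (t-sym : ∀ v w → t v w ≡ t w v)
         (d q : Fin n → ℕ) (Q : ℕ) (Q≤ : ∀ v w → t v w ≡ true → Q ≤ 2 * (q v * d v)) where

  private
    V = allFin n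
    -- When `t` is the relation of being a good edge, `T` is the number of ordered good pairs and
    -- `σ / Q` is, up to rounding, the S of the outline.
    T  = ∑[ v ← V ] ∑[ w ← V ] 𝟙 (t v w)
    σ  = ∑[ v ← V ] q v * (∑[ w ← V ] 𝟙 (t v w))

  ∑-𝟙*q : (∑[ v ← V ] ∑[ w ← V ] 𝟙 (t v w) * q v) ≡ σ
  ∑-𝟙*q = ∑-cong V λ v → trans (∑-*ʳ V (q v) _) (*-comm _ (q v))

  ∑-𝟙*q′ : (∑[ v ← V ] ∑[ w ← V ] 𝟙 (t v w) * q w) ≡ σ
  ∑-𝟙*q′ = trans (∑-comm V V _) (trans
    (∑-cong V λ w → ∑-cong V λ v → cong (λ b → 𝟙 b * q w) (t-sym v w)) ∑-𝟙*q)

  ∑-𝟙*c : ∀ c → (∑[ v ← V ] ∑[ w ← V ] 𝟙 (t v w) * c) ≡ T * c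
  ∑-𝟙*c c = trans (∑-cong V λ v → ∑-*ʳ V c _) (∑-*ʳ V c _)

  private
    -- An endpoint of degree at most `D` suffices alone: `1 ≤ D / d v`, multiplied by `D * D * Q`.
    -- The factor 2 pays for the rounding in `q v`.
    light : ∀ {D} v → Q ≤ 2 * (q v * d v) → d v ≤ D → D * D * Q ≤ 2 * (D * D * D) * q v
    light {D} v Q≤2qd dv≤D = begin
      D * D * Q                ≤⟨ *-monoʳ-≤ (D * D) (≤-trans Q≤2qd (*-monoʳ-≤ 2 (*-monoʳ-≤ (q v) dv≤D))) ⟩
      D * D * (2 * (q v * D))  ≡⟨ e D (q v) ⟩
      2 * (D * D * D) * q v    ∎
      where
      open ≤-Reasoning
      e : ∀ D q → D * D * (2 * (q * D)) ≡ 2 * (D * D * D) * q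
      e = solve-∀

  light-pair : ∀ D v w → 𝟙 (t v w) * (D * D * Q) ≤
               Q * (d v * d w) + 2 * (D * D * D) * (𝟙 (t v w) * q v + 𝟙 (t v w) * q w)
  light-pair D v w with t v w in tvw
  ... | false = z≤n
  ... | true rewrite *-identityˡ (D * D * Q) | *-identityˡ (q v) | *-identityˡ (q w)
    -- If both degrees are at least `D`, the product term is large enough; otherwise an endpoint of
    -- degree at most `D` is.
    with ≤-total D (d v) | ≤-total D (d w)
  ... | inj₁ D≤dv | inj₁ D≤dw =
    ≤-trans (≤-trans (≤-reflexive (*-comm (D * D) Q)) (*-monoʳ-≤ Q (*-mono-≤ D≤dv D≤dw))) (m≤m+n _ _)
  ... | inj₂ dv≤D | _ =
    ≤-trans (light v (Q≤ v w tvw) dv≤D)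
      (≤-trans (*-monoʳ-≤ (2 * (D * D * D)) (m≤m+n (q v) (q w))) (m≤n+m _ (Q * (d v * d w))))
  ... | _ | inj₂ dw≤D =
    ≤-trans (light w (Q≤ w v (trans (t-sym w v) tvw)) dw≤D)
      (≤-trans (*-monoʳ-≤ (2 * (D * D * D)) (m≤n+m (q w) (q v))) (m≤n+m _ (Q * (d v * d w))))

  -- The product term is summed over all pairs, in `t` or not, so that it factors into the square of
  -- the degree sum. By symmetry of `t` the two other terms both sum to `σ`.
  light-sum : ∀ D → T * (D * D * Q) ≤ Q * (∑ V d * ∑ V d) + 4 * (D * D * D) * σ
  light-sum D = begin
    T * (D * D * Q)
      ≡⟨ ∑-𝟙*c (D * D * Q) ⟨
    (∑[ v ← V ] ∑[ w ← V ] 𝟙 (t v w) * (D * D * Q))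
      ≤⟨ ∑-mono V (λ v → ∑-mono V (light-pair D v)) ⟩
    (∑[ v ← V ] ∑[ w ← V ] Q * (d v * d w) + K * (𝟙 (t v w) * q v + 𝟙 (t v w) * q w))
      ≡⟨ ∑-cong V (λ v → ∑-+ V _ _) ⟩
    (∑[ v ← V ] (∑[ w ← V ] Q * (d v * d w)) + (∑[ w ← V ] K * (𝟙 (t v w) * q v + 𝟙 (t v w) * q w)))
      ≡⟨ ∑-+ V _ _ ⟩
    (∑[ v ← V ] ∑[ w ← V ] Q * (d v * d w)) +
    (∑[ v ← V ] ∑[ w ← V ] K * (𝟙 (t v w) * q v + 𝟙 (t v w) * q w))
      ≡⟨ cong₂ _+_ degrees shares ⟩
    Q * (∑ V d * ∑ V d) + K * (σ + σ)
      ≡⟨ cong (Q * (∑ V d * ∑ V d) +_) (e D σ) ⟩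
    Q * (∑ V d * ∑ V d) + 4 * (D * D * D) * σ ∎
    where
    open ≤-Reasoning
    K = 2 * (D * D * D)

    e : ∀ D σ → 2 * (D * D * D) * (σ + σ) ≡ 4 * (D * D * D) * σ
    e = solve-∀

    degrees : (∑[ v ← V ] ∑[ w ← V ] Q * (d v * d w)) ≡ Q * (∑ V d * ∑ V d)
    degrees = begin-equality
      (∑[ v ← V ] ∑[ w ← V ] Q * (d v * d w))
        ≡⟨ ∑-cong V (λ v → trans (∑-*ˡ V Q _) (cong (Q *_) (∑-*ˡ V (d v) d))) ⟩
      (∑[ v ← V ] Q * (d v * ∑ V d))           ≡⟨ trans (∑-*ˡ V Q _) (cong (Q *_) (∑-*ʳ V (∑ V d) d)) ⟩
      Q * (∑ V d * ∑ V d)                      ∎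

    shares : (∑[ v ← V ] ∑[ w ← V ] K * (𝟙 (t v w) * q v + 𝟙 (t v w) * q w)) ≡ K * (σ + σ)
    shares = begin-equality
      (∑[ v ← V ] ∑[ w ← V ] K * (𝟙 (t v w) * q v + 𝟙 (t v w) * q w))
        ≡⟨ ∑-cong V (λ v → trans (∑-*ˡ V K _) (cong (K *_) (∑-+ V _ _))) ⟩
      (∑[ v ← V ] K * ((∑[ w ← V ] 𝟙 (t v w) * q v) + (∑[ w ← V ] 𝟙 (t v w) * q w)))
        ≡⟨ trans (∑-*ˡ V K _) (cong (K *_) (∑-+ V _ _)) ⟩
      K * ((∑[ v ← V ] ∑[ w ← V ] 𝟙 (t v w) * q v) + (∑[ v ← V ] ∑[ w ← V ] 𝟙 (t v w) * q w))
        ≡⟨ cong (K *_) (cong₂ _+_ ∑-𝟙*q ∑-𝟙*q′) ⟩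
      K * (σ + σ) ∎

  -- Every pair in `t` contributes some `q v` to `σ`, which is at least `Q / (2 * n)` when degrees
  -- are at most `n`.
  bounded-degree-sum : (∀ v → d v ≤ n) → T * Q ≤ 2 * n * σ
  bounded-degree-sum d≤n = begin
    T * Q                                            ≡⟨ ∑-𝟙*c Q ⟨
    (∑[ v ← V ] ∑[ w ← V ] 𝟙 (t v w) * Q)            ≤⟨ ∑-mono V (λ v → ∑-mono V (pointwise v)) ⟩
    (∑[ v ← V ] ∑[ w ← V ] 2 * n * (𝟙 (t v w) * q v)) ≡⟨ ∑-cong V (λ v → ∑-*ˡ V (2 * n) _) ⟩
    (∑[ v ← V ] 2 * n * (∑[ w ← V ] 𝟙 (t v w) * q v))
      ≡⟨ trans (∑-*ˡ V (2 * n) _) (cong (2 * n *_) ∑-𝟙*q) ⟩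
    2 * n * σ                                        ∎
    where
    open ≤-Reasoning
    e : ∀ n q → 2 * (q * n) ≡ 2 * n * (1 * q)
    e = solve-∀
    pointwise : ∀ v w → 𝟙 (t v w) * Q ≤ 2 * n * (𝟙 (t v w) * q v)
    pointwise v w with t v w in tvw
    ... | false = z≤n
    ... | true  = begin
      1 * Q               ≡⟨ *-identityˡ Q ⟩
      Q                   ≤⟨ Q≤ v w tvw ⟩
      2 * (q v * d v)     ≤⟨ *-monoʳ-≤ 2 (*-monoʳ-≤ (q v) (d≤n v)) ⟩
      2 * (q v * n)       ≡⟨ e n (q v) ⟩
      2 * n * (1 * q v)   ∎

  -- The two bounds on S from the outline, each halved by the rounding in `q`: `Q ≤ σ` if `n ≤ M`,
  -- and `Q ≤ 8 * σ` if `m * m ≤ M * M * M`.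
  Q≤8σ : ∀ m M .{{_ : NonZero n}} .{{_ : NonZero m}} → (∀ v → d v ≤ n) → ∑ V d ≡ 2 * m → T ≡ 2 * M →
         n ≤ M ⊎ m * m ≤ M * M * M → Q ≤ 8 * σ
  Q≤8σ m M d≤n ∑d T≡ (inj₁ n≤M) = ≤-trans (*-cancelˡ-≤ (2 * n) {{m*n≢0 2 n}} (begin
    2 * n * Q    ≤⟨ *-monoˡ-≤ Q (*-monoʳ-≤ 2 n≤M) ⟩
    2 * M * Q    ≡⟨ cong (_* Q) T≡ ⟨
    T * Q        ≤⟨ bounded-degree-sum d≤n ⟩
    2 * n * σ    ∎)) (m≤n*m σ 8)
    where open ≤-Reasoning
  -- For `D = 2 * M` the left side of `light-sum` is `8 * M³ * Q`. The product term takes up at most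
  -- half of it, which is cancelled; the other half is left for `σ`.
  Q≤8σ m M d≤n ∑d T≡ (inj₂ m²≤M³) = *-cancelˡ-≤ (4 * M³) {{m*n≢0 4 M³}} (+-cancelˡ-≤ (4 * M³ * Q) _ _ (begin
    4 * M³ * Q + 4 * M³ * Q                          ≡⟨ e₁ M Q ⟩
    2 * M * (2 * M * (2 * M) * Q)                    ≡⟨ cong (_* (2 * M * (2 * M) * Q)) T≡ ⟨
    T * (2 * M * (2 * M) * Q)                        ≤⟨ light-sum (2 * M) ⟩
    Q * (∑ V d * ∑ V d) + 4 * (2 * M * (2 * M) * (2 * M)) * σ
      ≡⟨ cong (λ S → Q * (S * S) + 4 * (2 * M * (2 * M) * (2 * M)) * σ) ∑d ⟩
    Q * (2 * m * (2 * m)) + 4 * (2 * M * (2 * M) * (2 * M)) * σ  ≡⟨ e₂ Q m M σ ⟩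
    4 * (m * m) * Q + 4 * M³ * (8 * σ)               ≤⟨ +-monoˡ-≤ _ (*-monoˡ-≤ Q (*-monoʳ-≤ 4 m²≤M³)) ⟩
    4 * M³ * Q + 4 * M³ * (8 * σ)                    ∎))
    where
    open ≤-Reasoning
    M³ = M * M * M
    instance
      M³≢0 : NonZero M³
      M³≢0 = >-nonZero (<-≤-trans (>-nonZero⁻¹ (m * m) {{m*n≢0 m m}}) m²≤M³)
    e₁ : ∀ M Q → 4 * (M * M * M) * Q + 4 * (M * M * M) * Q ≡ 2 * M * (2 * M * (2 * M) * Q)
    e₁ = solve-∀
    e₂ : ∀ Q m M σ → Q * (2 * m * (2 * m)) + 4 * (2 * M * (2 * M) * (2 * M)) * σ ≡
                     4 * (m * m) * Q + 4 * (M * M * M) * (8 * σ)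
    e₂ = solve-∀

-- Comparison with m^(-1/3)

-- Not opened earlier, because it makes the operator sections (x +_) ambiguous.
open import Data.Integer using (+_)

/-mono-< : ∀ a b c d .{{_ : NonZero b}} .{{_ : NonZero d}} →
           a * d < c * b → + a / b ℚ.< + c / d
/-mono-< a (suc b) c (suc d) ad<cb = ℚ.toℚᵘ-cancel-<
  (ℚᵘ.<-respˡ-≃ (ℚᵘ.≃-sym (ℚ.toℚᵘ-fromℚᵘ (ℚᵘ.mkℚᵘ (+ a) b)))
    (ℚᵘ.<-respʳ-≃ (ℚᵘ.≃-sym (ℚ.toℚᵘ-fromℚᵘ (ℚᵘ.mkℚᵘ (+ c) d)))
      (ℚᵘ.*<* (subst₂ ℤ._<_ (ℤ.pos-* a (suc d)) (ℤ.pos-* c (suc b)) (ℤ.+<+ ad<cb)))))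

0≤/ : ∀ a b .{{_ : NonZero b}} → 0ℚ ℚ.≤ + a / b
0≤/ a b = ℚ.nonNegative⁻¹ (+ a / b) {{ℚ.normalize-nonNeg a b}}

cube-/-< : ∀ a b m .{{_ : NonZero b}} .{{_ : NonZero m}} →
           a * a * a * m < b * b * b → cube (+ a / b) ℚ.< ℤ.1ℤ / m
cube-/-< a (suc b) (suc m) a³m<b³ = ℚ.toℚᵘ-cancel-<
  (ℚᵘ.<-respˡ-≃ (ℚᵘ.≃-sym cube≃)
    (ℚᵘ.<-respʳ-≃ (ℚᵘ.≃-sym (ℚ.toℚᵘ-fromℚᵘ (ℚᵘ.mkℚᵘ ℤ.1ℤ m)))
      (ℚᵘ.*<* (subst₂ ℤ._<_ eq (sym (ℤ.*-identityˡ _)) (ℤ.+<+ a³m<b³)))))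
  where
  a/b = ℚᵘ.mkℚᵘ (+ a) b
  x = + a / suc b

  x≃ : ℚ.toℚᵘ x ℚᵘ.≃ a/b
  x≃ = ℚ.toℚᵘ-fromℚᵘ a/b

  cube≃ : ℚ.toℚᵘ (cube x) ℚᵘ.≃ a/b ℚᵘ.* a/b ℚᵘ.* a/b
  cube≃ = ℚᵘ.≃-trans (ℚ.toℚᵘ-homo-* (x ℚ.* x) x)
    (ℚᵘ.*-cong (ℚᵘ.≃-trans (ℚ.toℚᵘ-homo-* x x) (ℚᵘ.*-cong x≃ x≃)) x≃)

  eq : + (a * a * a * suc m) ≡ (+ a ℤ.* + a ℤ.* + a) ℤ.* + suc m
  eq = trans (ℤ.pos-* (a * a * a) (suc m))
    (cong (ℤ._* + suc m) (trans (ℤ.pos-* (a * a) a) (cong (ℤ._* + a) (ℤ.pos-* a a))))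

-- If M / m is below m^(-1/3), then so is (M + 1/k) / m for this k.
step : ℕ → ℕ
step M = 3 * (M * M) + 3 * M + 2

-- By integrality `M³ + 1 ≤ m²`, while replacing `M` by `M + 1/k` raises the cube by
-- `3M²/k + 3M/k² + 1/k³`, which is less than 1 because `k` exceeds `3M² + 3M + 1`.
cube-step : ∀ M m → M * M * M < m * m →
  let k = step M in
  (M * k + 1) * (M * k + 1) * (M * k + 1) * m < (m * k) * (m * k) * (m * k)
cube-step M m@(suc _) M³<m² = begin-strict
  (M * k + 1) * (M * k + 1) * (M * k + 1) * m
    <⟨ *-monoˡ-< m lt ⟩
  m * m * (k * k * k) * m
    ≡⟨ e₃ m k ⟩
  (m * k) * (m * k) * (m * k) ∎
  where
  open ≤-Reasoning
  k = step M

  e₁ : ∀ M k → (M * k + 1) * (M * k + 1) * (M * k + 1) ≡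
               M * M * M * (k * k * k) + (3 * (M * M) * (k * k) + 3 * M * k + 1)
  e₁ = solve-∀
  e₂ : ∀ M k → (3 * (M * M) + 3 * M + 2) * (k * k) ≡ 3 * (M * M) * (k * k) + 3 * M * (k * k) + 2 * (k * k)
  e₂ = solve-∀
  e₃ : ∀ m k → m * m * (k * k * k) * m ≡ (m * k) * (m * k) * (m * k)
  e₃ = solve-∀

  1≤k : 1 ≤ k
  1≤k = ≤-trans (s≤s z≤n) (m≤n+m 2 (3 * (M * M) + 3 * M))

  instance
    _ = >-nonZero 1≤k

  1<2k² : 1 < 2 * (k * k)
  1<2k² = *-monoʳ-≤ 2 (*-mono-≤ 1≤k 1≤k)

  rest : 3 * (M * M) * (k * k) + 3 * M * k + 1 < k * k * k
  rest = begin-strict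
    3 * (M * M) * (k * k) + 3 * M * k + 1
      ≤⟨ +-monoˡ-≤ 1 (+-monoʳ-≤ (3 * (M * M) * (k * k)) (*-monoʳ-≤ (3 * M) (m≤m*n k k))) ⟩
    3 * (M * M) * (k * k) + 3 * M * (k * k) + 1
      <⟨ +-monoʳ-< (3 * (M * M) * (k * k) + 3 * M * (k * k)) 1<2k² ⟩
    3 * (M * M) * (k * k) + 3 * M * (k * k) + 2 * (k * k)
      ≡⟨ e₂ M k ⟨
    k * (k * k)
      ≡⟨ *-assoc k k k ⟨
    k * k * k ∎

  lt : (M * k + 1) * (M * k + 1) * (M * k + 1) < m * m * (k * k * k)
  lt = begin-strict
    (M * k + 1) * (M * k + 1) * (M * k + 1)
      ≡⟨ e₁ M k ⟩
    M * M * M * (k * k * k) + (3 * (M * M) * (k * k) + 3 * M * k + 1)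
      <⟨ +-monoʳ-< (M * M * M * (k * k * k)) rest ⟩
    M * M * M * (k * k * k) + k * k * k
      ≡⟨ +-comm (M * M * M * (k * k * k)) (k * k * k) ⟩
    suc (M * M * M) * (k * k * k)
      ≤⟨ *-monoˡ-≤ (k * k * k) M³<m² ⟩
    m * m * (k * k * k) ∎

-- If both alternatives fail, `M / m` lies in the lower cuts of `n / m` and of the cube root, so the
-- hypothesis yields `M / m < M / m`. The lower cut of the root demands a rational strictly above
-- `M / m` as witness, which `step` provides.
min≤/⇒ : ∀ n m M .{{_ : NonZero m}} →
         min (m ^-⅓) (fromℚ (+ n / m)) ≤ℝ fromℚ (+ M / m) → n ≤ M ⊎ m * m ≤ M * M * M
min≤/⇒ n m M min≤ with n ≤? M | m * m ≤? M * M * M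
... | yes n≤M | _        = inj₁ n≤M
... | no  n≰M | yes m²≤ = inj₂ m²≤
... | no  n≰M | no  m²≰ = contradiction (min≤ (below-root , below-n/m)) (ℚ.<-irrefl refl)
  where
  k = step M
  instance
    k≢0 : NonZero k
    k≢0 = >-nonZero (≤-trans (s≤s z≤n) (m≤n+m 2 (3 * (M * M) + 3 * M)))
    mk≢0 : NonZero (m * k)
    mk≢0 = m*n≢0 m k

  e : ∀ M m k → M * (m * k) + m ≡ (M * k + 1) * m
  e = solve-∀

  below-n/m : + M / m ℚ.< + n / m
  below-n/m = /-mono-< M m n m (*-monoˡ-< m (≰⇒> n≰M))

  below-root : ∃[ r ] 0ℚ ℚ.≤ r × + M / m ℚ.< r × cube r ℚ.< ℤ.1ℤ / m
  below-root =
    + (M * k + 1) / (m * k) ,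
    0≤/ (M * k + 1) (m * k) ,
    /-mono-< M m (M * k + 1) (m * k)
      (<-≤-trans (m<m+n (M * (m * k)) (>-nonZero⁻¹ m)) (≤-reflexive (e M m k))) ,
    cube-/-< (M * k + 1) (m * k) m (cube-step M m (≰⇒> m²≰))

-- Probabilities of events

Pr≥⅔-certain : ∀ {k n} {P : Pred (Vec (Bits k) n) 0ℓ} (P? : Decidable P) → (∀ ω → P ω) → Pr≥⅔ P?
Pr≥⅔-certain {k} {n} P? p = begin
  2 * length O              ≤⟨ *-monoˡ-≤ (length O) (m≤m+n 2 1) ⟩
  3 * length O              ≡⟨ cong (λ xs → 3 * length xs) (filter-all P? (universal p O)) ⟨
  3 * length (filter P? O)  ∎
  where
  open ≤-Reasoning
  O = outcomes k n

length-filter+¬ : ∀ {A : Set} {P : Pred A 0ℓ} (P? : Decidable P) xs →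
                  length (filter P? xs) + (∑[ x ← xs ] 𝟙 (not (does (P? x)))) ≡ length xs
length-filter+¬ P? xs = begin
  length (filter P? xs) + (∑[ x ← xs ] 𝟙 (not (does (P? x))))
    ≡⟨ cong (_+ _) (length-filter-∑ P? xs) ⟩
  (∑[ x ← xs ] 𝟙 (does (P? x))) + (∑[ x ← xs ] 𝟙 (not (does (P? x))))
    ≡⟨ ∑-+ xs _ _ ⟨
  (∑[ x ← xs ] 𝟙 (does (P? x)) + 𝟙 (not (does (P? x))))
    ≡⟨ ∑-cong xs (λ x → 𝟙-not (does (P? x))) ⟩
  (∑[ _ ← xs ] 1)
    ≡⟨ length-∑ xs ⟨
  length xs ∎
  where open ≡-Reasoning

Pr≥⅔-complement : ∀ {k n} {P : Pred (Vec (Bits k) n) 0ℓ} (P? : Decidable P) →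
  3 * (∑[ ω ← outcomes k n ] 𝟙 (not (does (P? ω)))) ≤ length (outcomes k n) → Pr≥⅔ P?
Pr≥⅔-complement {k} {n} P? 3f≤L = +-cancelʳ-≤ (3 * f) _ _ (begin
  2 * L + 3 * f      ≤⟨ +-monoʳ-≤ (2 * L) 3f≤L ⟩
  2 * L + L          ≡⟨ e L ⟩
  3 * L              ≡⟨ cong (3 *_) (length-filter+¬ P? O) ⟨
  3 * (s + f)        ≡⟨ *-distribˡ-+ 3 s f ⟩
  3 * s + 3 * f      ∎)
  where
  open ≤-Reasoning
  O = outcomes k n
  L = length O
  s = length (filter P? O)
  f = ∑[ ω ← O ] 𝟙 (not (does (P? ω)))
  e : ∀ L → 2 * L + L ≡ 3 * L
  e = solve-∀

length-bits : ∀ k → length (bits k) ≡ 2 ^ k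
length-bits = length-vectors (true ∷ false ∷ [])

-- Each of n nodes draws R independent samples of k bits.
module _ {n : ℕ} (R k : ℕ) (hit : Fin n → Bits k → Bool) where

  private
    Q = 2 ^ k
    instance
      Q≢0 : NonZero Q
      Q≢0 = m^n≢0 2 k

  sample : Vec (Bits (R * k)) n → Fin n → Fin R → Bits k
  sample ω v j = lookup (chunk R (lookup ω v)) j

  -- If `P` fails, all samples miss. With `p v` the chance that a sample of `v` hits, this has
  -- probability at most `1 / (1 + R * ∑ p)`, which is at most 1/3 once `R * ∑ p ≥ 2`.
  Pr≥⅔-hit : {P : Pred (Vec (Bits (R * k)) n) 0ℓ} (P? : Decidable P) →
             (∀ ω v j → hit v (sample ω v j) ≡ true → P ω) →
             2 * Q ≤ R * (∑[ v ← allFin n ] ∑[ x ← bits k ] 𝟙 (hit v x)) →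
             Pr≥⅔ P?
  Pr≥⅔-hit {P} P? hit⇒P 2Q≤ = Pr≥⅔-complement P? (≤-trans (*-monoʳ-≤ 3 misses) few-misses)
    where
    open ≤-Reasoning
    V = allFin n
    O = outcomes (R * k) n

    s f : Fin n → ℕ
    s v = ∑[ x ← bits k ] 𝟙 (hit v x)
    f v = ∑[ x ← bits k ] 𝟙 (not (hit v x))

    f+s≡Q : ∀ v → f v + s v ≡ Q
    f+s≡Q v = begin-equality
      f v + s v                                          ≡⟨ +-comm (f v) (s v) ⟩
      s v + f v                                          ≡⟨ ∑-+ (bits k) _ _ ⟨
      (∑[ x ← bits k ] 𝟙 (hit v x) + 𝟙 (not (hit v x)))  ≡⟨ ∑-cong (bits k) (λ x → 𝟙-not (hit v x)) ⟩
      (∑[ _ ← bits k ] 1)                                ≡⟨ length-∑ (bits k) ⟨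
      length (bits k)                                    ≡⟨ length-bits k ⟩
      Q                                                  ∎

    miss : Fin n → Bits (R * k) → ℕ
    miss v x = ∏ R (λ j → 𝟙 (not (hit v (lookup (chunk R x) j))))

    ¬P⇒miss : ∀ ω → 𝟙 (not (does (P? ω))) ≤ ∏ n (λ v → miss v (lookup ω v))
    ¬P⇒miss ω with P? ω
    ... | yes _  = z≤n
    ... | no ¬p = ≤-reflexive (sym (∏-1 n _ λ v → ∏-1 R _ λ j →
                    cong (𝟙 ∘ not) (𝔹.¬-not (¬p ∘ hit⇒P ω v j))))

    misses : (∑[ ω ← O ] 𝟙 (not (does (P? ω)))) ≤ ∏ n (λ v → f v ^ R)
    misses = begin
      (∑[ ω ← O ] 𝟙 (not (does (P? ω))))               ≤⟨ ∑-mono O ¬P⇒miss ⟩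
      (∑[ ω ← O ] ∏ n (λ v → miss v (lookup ω v)))     ≡⟨ ∑-vectors (bits (R * k)) n miss ⟩
      ∏ n (λ v → ∑[ x ← bits (R * k) ] miss v x)
        ≡⟨ ∏-cong n (λ v → ∑-chunk (true ∷ false ∷ []) R _) ⟩
      ∏ n (λ v → f v ^ R)                              ∎

    O-length : length O ≡ (Q ^ R) ^ n
    O-length = begin-equality
      length O                    ≡⟨ length-vectors (bits (R * k)) n ⟩
      length (bits (R * k)) ^ n   ≡⟨ cong (_^ n) (length-bits (R * k)) ⟩
      (2 ^ (R * k)) ^ n           ≡⟨ cong (λ e → (2 ^ e) ^ n) (*-comm R k) ⟩
      (2 ^ (k * R)) ^ n           ≡⟨ cong (_^ n) (^-*-assoc 2 k R) ⟨
      (Q ^ R) ^ n                 ∎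

    few-misses : 3 * ∏ n (λ v → f v ^ R) ≤ length O
    few-misses = *-cancelˡ-≤ Q (begin
      Q * (3 * F)                         ≡⟨ e Q F ⟩
      F * (Q + 2 * Q)                     ≤⟨ *-monoʳ-≤ F (+-monoʳ-≤ Q 2Q≤) ⟩
      F * (Q + R * ∑ V s)                 ≡⟨ cong (λ t → F * (Q + t)) (∑-*ˡ V R s) ⟨
      F * (Q + (∑[ v ← V ] R * s v))      ≤⟨ failure-∏ Q n _ _ (λ v → failure-^ Q R (f+s≡Q v)) ⟩
      Q * (Q ^ R) ^ n                     ≡⟨ cong (Q *_) O-length ⟨
      Q * length O                        ∎)
      where
      F = ∏ n (λ v → f v ^ R)
      e : ∀ Q F → Q * (3 * F) ≡ F * (Q + 2 * Q)
      e = solve-∀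

-- The algorithm

-- The states before the first round, between the two rounds, and after the second.
data NodeState (i c d : ℕ) : Set where
  waiting  : Bits i → Bits c → NodeState i c d
  informed : (Fin d → Bits i) → Bits c → NodeState i c d
  decided  : Bool → NodeState i c d

module _ (r : ℕ) where

  private
    -- Positive, so that a first-round message has a first block to read.
    R = suc r

  -- The message through `p` lists neighbours of the node behind `p`; an own neighbour among them
  -- closes a triangle.
  Echo : ∀ {i d} → (Fin d → Bits i) → (Fin d → Bits (R * i)) → Set
  Echo ids msgs = ∃[ p ] ∃[ j ] ∃[ q ] lookup (chunk R (msgs p)) j ≡ ids q

  echo? : ∀ {i d} (ids : Fin d → Bits i) msgs → Dec (Echo ids msgs)
  echo? ids msgs = Fin.any? λ p → Fin.any? λ j → Fin.any? λ q →
    ≡-dec 𝔹._≟_ (lookup (chunk R (msgs p)) j) (ids q)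

  -- In the first round nodes announce their identifiers (only the first of the R copies is
  -- read), in the second those of R random neighbours.
  tester : ∀ i k → Algorithm i (R * i)
  tester i k = record
    { coins   = R * k
    ; State   = NodeState i (R * k)
    ; init    = λ _ → waiting
    ; send    = λ where
        (waiting id _)     _ → concat (replicate R id)
        -- The choice depends on the coins alone, so all neighbours are told the same samples, among
        -- them the third vertex of a triangle on a sampled good edge.
        (informed ids ω)   p → concat (Vec.map (λ x → ids (pick p x)) (chunk R ω))
        (decided _)        _ → replicate (R * i) false
    ; receive = λ where
        (waiting _ ω)    msgs → informed (λ p → Vec.head (chunk R (msgs p))) ω
        (informed ids _) msgs → decided (not (does (echo? ids msgs)))
        (decided b)      _    → decided b
    ; accept  = λ where
        (decided b) → b
        _           → true
    }

  -- Correctness of the tester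

  module _ {n i k : ℕ} (N : Network n i) where
    open Network N
    open Execution (tester i k) N

    private
      G = graph

    port : ∀ {v w} → adj G v w ≡ true → Fin (deg v)
    port {v} {w} vw = Inverse.from (ports v) (w , vw)

    neighbour-port : ∀ {v w} (vw : adj G v w ≡ true) → neighbour v (port vw) ≡ w
    neighbour-port {v} {w} vw = cong proj₁ (Inverse.strictlyInverseˡ (ports v) (w , vw))

    adj-neighbour : ∀ v p → adj G v (neighbour v p) ≡ true
    adj-neighbour v p = proj₂ (Inverse.to (ports v) p)

    inTrianglePort : ∀ v → Fin (deg v) → Bool
    inTrianglePort v p = inTriangle G v (neighbour v p)

    hit : Fin n → Bits k → Bool
    hit v = hits (inTrianglePort v)

    module _ (ω : Vec (Bits (R * k)) n) where

      -- `heard` and `received` are the data of the two rounds exactly as the execution computes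
      -- them, so `accepts 2 ω v` unfolds to the negation of `echo?` on them.
      heard : ∀ v → Fin (deg v) → Bits i
      heard v p = Vec.head (chunk R (concat (replicate R (ident (neighbour v p)))))

      received : ∀ v → Fin (deg v) → Bits (R * i)
      received v p = concat (Vec.map
        (λ x → heard (neighbour v p) (pick (reversePort v p) x)) (chunk R (lookup ω (neighbour v p))))

      heard≡ : ∀ v p → heard v p ≡ ident (neighbour v p)
      heard≡ v p = cong Vec.head (chunk-concat (replicate R (ident (neighbour v p))))

      received≡ : ∀ v p j → let u = neighbour v p in
        lookup (chunk R (received v p)) j ≡
        ident (neighbour u (pick (reversePort v p) (sample R k hit ω u j)))
      received≡ v p j = begin
        lookup (chunk R (received v p)) j
          ≡⟨ cong (λ xs → lookup xs j) (chunk-concat (Vec.map _ (chunk R (lookup ω u)))) ⟩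
        lookup (Vec.map (λ x → heard u (pick (reversePort v p) x)) (chunk R (lookup ω u))) j
          ≡⟨ lookup-map j _ (chunk R (lookup ω u)) ⟩
        heard u (pick (reversePort v p) (lookup (chunk R (lookup ω u)) j))
          ≡⟨ heard≡ u _ ⟩
        ident (neighbour u (pick (reversePort v p) (sample R k hit ω u j))) ∎
        where
        open ≡-Reasoning
        u = neighbour v p

      -- The error is one-sided: as identifiers are unique, an echo exhibits an actual triangle,
      -- whatever the coins.
      triangleFree⇒accepts : TriangleFree G → ∀ v → accepts 2 ω v ≡ true
      triangleFree⇒accepts free v = cong not (dec-false (echo? (heard v) (received v)) λ
        (p , j , q , eq) →
          let u  = neighbour v p
              x  = pick (reversePort v p) (sample R k hit ω u j)
              w≡ = ident-unique (trans (sym (received≡ v p j)) (trans eq (heard≡ v q)))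
          in free (v , u , neighbour u x , adj-neighbour v p , adj-neighbour u x ,
                   trans (cong (adj G v) w≡) (adj-neighbour v q)))

      -- If `v` samples a good edge to `w`, the rejecting node is a common neighbour `u` of both: it
      -- hears of `w` from `v` and has `w` as a neighbour itself.
      hit⇒rejects : ∀ v j → hit v (sample R k hit ω v j) ≡ true → ∃[ u ] accepts 2 ω u ≡ false
      hit⇒rejects v j h =
        let y = sample R k hit ω v j
            p , vwu = hits-pick (inTrianglePort v) y h
            w = neighbour v (pick p y)
            _ , u , vu , wu = does-true (inTriangle? G v w) vwu
            uv = trans (symmetric G u v) vu
            uw = trans (symmetric G u w) wu
        in u , cong not (dec-true (echo? (heard u) (received u))
             (port uv , j , port uw ,
              (trans (received≡ u (port uv) j)
              (trans (cong ident (same-choice (neighbour-port uv) _ p))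
              (sym (trans (heard≡ u (port uw)) (cong ident (neighbour-port uw))))))))
        where
        -- The node behind the port of `u` leading to `v` equals `v` only propositionally, and the
        -- witness ports passed to `pick` differ; neither changes the sampled neighbour.
        same-choice : ∀ {v′} → v′ ≡ v → (p′ : Fin (deg v′)) (p : Fin (deg v)) →
          neighbour v′ (pick p′ (sample R k hit ω v′ j)) ≡ neighbour v (pick p (sample R k hit ω v j))
        same-choice refl p′ p = cong (neighbour v) (pick-irrelevant p′ p _)

    deg≡ : ∀ v → deg v ≡ (∑[ w ← allFin n ] 𝟙 (adj G v w))
    deg≡ v = trans (sym (∑-allFin-1 (deg v))) (trans (∑-↔ (ports v) (λ _ → 1))
      (∑-cong (allFin n) λ w → *-identityʳ (𝟙 (adj G v w))))

    deg≤n : ∀ v → deg v ≤ n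
    deg≤n v = begin
      deg v                              ≡⟨ deg≡ v ⟩
      (∑[ w ← allFin n ] 𝟙 (adj G v w))  ≤⟨ ∑-mono (allFin n) (λ w → 𝟙≤1 (adj G v w)) ⟩
      (∑[ w ← allFin n ] 1)              ≡⟨ ∑-allFin-1 n ⟩
      n                                  ∎
      where
      open ≤-Reasoning
      𝟙≤1 : ∀ b → 𝟙 b ≤ 1
      𝟙≤1 false = z≤n
      𝟙≤1 true  = ≤-refl

    ∑-deg : ∑ (allFin n) deg ≡ 2 * ∣E∣ G
    ∑-deg = trans (∑-cong (allFin n) deg≡) (∑-adj G)

    ∑-inTrianglePort : ∀ v → (∑[ p ← allFin (deg v) ] 𝟙 (inTrianglePort v p)) ≡
                             (∑[ w ← allFin n ] 𝟙 (inTriangle G v w))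
    ∑-inTrianglePort v = trans (∑-↔ (ports v) (𝟙 ∘ inTriangle G v))
      (∑-cong (allFin n) λ w → absorb (adj G v w) (inTriangle G v w) (inTriangle-adj G v w))
      where
      absorb : ∀ a b → (b ≡ true → a ≡ true) → 𝟙 a * 𝟙 b ≡ 𝟙 b
      absorb a     false _   = *-zeroʳ (𝟙 a)
      absorb true  true  _   = refl
      absorb false true  b⇒a = contradiction (b⇒a refl) λ ()

    tester-tests : ∀ ε .{{_ : NonZero n}} .{{_ : NonZero (∣E∣ G)}} → n ≤ 2 ^ k → 16 ≤ R →
      min (∣E∣ G ^-⅓) (fromℚ (+ n / ∣E∣ G)) ≤ℝ ε → TestsTriangleFreeness (tester i k) 2 N ε
    tester-tests ε n≤Q 16≤R min≤ε =
      (λ free → Pr≥⅔-certain (allAccept? (tester i k) 2 N) λ ω → triangleFree⇒accepts ω free) ,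
      (λ far → Pr≥⅔-hit R k hit (someRejects? (tester i k) 2 N) hit⇒rejects (many-hits far))
      where
      open ≤-Reasoning
      V = allFin n
      Q = 2 ^ k
      M = dist G (withoutTriangles G)

      q : Fin n → ℕ
      q v = quot Q (deg v)

      Q≤2qd : ∀ v w → inTriangle G v w ≡ true → Q ≤ 2 * (q v * deg v)
      Q≤2qd v w vw = quot-lower Q (deg v) {{Fin.nonZeroIndex (port (inTriangle-adj G v w vw))}}
        (≤-trans (deg≤n v) n≤Q)

      σ≤hits : (∑[ v ← V ] q v * (∑[ w ← V ] 𝟙 (inTriangle G v w))) ≤
               (∑[ v ← V ] ∑[ x ← bits k ] 𝟙 (hit v x))
      σ≤hits = ∑-mono V λ v → begin
        q v * (∑[ w ← V ] 𝟙 (inTriangle G v w))               ≡⟨ cong (q v *_) (∑-inTrianglePort v) ⟨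
        q v * (∑[ p ← allFin (deg v) ] 𝟙 (inTrianglePort v p)) ≤⟨ ∑-hits k (inTrianglePort v) ⟩
        (∑[ x ← bits k ] 𝟙 (hit v x))                         ∎

      many-hits : FarFromTriangleFree ε G → 2 * Q ≤ R * (∑[ v ← V ] ∑[ x ← bits k ] 𝟙 (hit v x))
      many-hits far = begin
        2 * Q             ≤⟨ *-monoʳ-≤ 2 (Q≤8σ (inTriangle G) (inTriangle-sym G) deg q Q Q≤2qd
                               (∣E∣ G) M deg≤n ∑-deg (∑-inTriangle G)
                               -- The assumption on `ε` and farness from `withoutTriangles G`
                               -- compose, which eliminates `ε` and bounds the minimum by `M / m`.
                               (min≤/⇒ n (∣E∣ G) M λ {x} l →
                                 far (withoutTriangles G) (withoutTriangles-triangleFree G) {x} (min≤ε {x} l))) ⟩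
        -- The 16 samples: 2 for a failure probability of 1/3, times 8 from the bound on `σ`.
        2 * (8 * σ)       ≡⟨ *-assoc 2 8 σ ⟨
        16 * σ            ≤⟨ *-mono-≤ 16≤R σ≤hits ⟩
        R * (∑[ v ← V ] ∑[ x ← bits k ] 𝟙 (hit v x)) ∎
        where
        σ = ∑[ v ← V ] q v * (∑[ w ← V ] 𝟙 (inTriangle G v w))

-- Choice of parameters

∣E∣≢0⇒n≢0 : ∀ {n} (G : Graph n) .{{_ : NonZero (∣E∣ G)}} → NonZero n
∣E∣≢0⇒n≢0 {zero}  G = contradiction refl (≢-nonZero⁻¹ (∣E∣ G))
∣E∣≢0⇒n≢0 {suc n} G = _

-- The bandwidth is an argument so that its product can be reassociated by `subst`.
TesterOfBandwidth : (n i : ℕ) → ℝ → ℕ → Set₁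
TesterOfBandwidth n i ε B =
  Σ[ A ∈ Algorithm i B ] ((N : Network n i) → let m = ∣E∣ (Network.graph N) in
    .{{_ : NonZero m}} →
    min (m ^-⅓) (fromℚ (+ n / m)) ≤ℝ ε → ε ≤ℝ fromℚ 1ℚ →
    TestsTriangleFreeness A 2 N ε)

bandwidth-tester : ∀ n i ε r → 16 ≤ suc r → TesterOfBandwidth n i ε (suc r * i)
bandwidth-tester n i ε r 16≤R = tester r i n , λ N min≤ε _ →
  -- Local coins are free in the model, so each sample may use `n` of them; this gives `2 ^ n ≥ n`.
  tester-tests r {k = n} N ε {{∣E∣≢0⇒n≢0 (Network.graph N)}} (n≤2^n n) 16≤R min≤ε

mainTheorem5 : ∃[ rounds ] ((c : ℕ) → ∃[ C ] ((n : ℕ) (ε : ℝ) →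
    Σ[ A ∈ Algorithm (c * ⌈log₂ n ⌉) (C * ⌈log₂ n ⌉) ]
    ((N : Network n (c * ⌈log₂ n ⌉)) → let m = ∣E∣ (Network.graph N) in
    .{{_ : NonZero m}} →
    min (m ^-⅓) (fromℚ (+ n / m)) ≤ℝ ε → ε ≤ℝ fromℚ 1ℚ →
    TestsTriangleFreeness A rounds N ε)))
-- A message holds 16 identifiers, hence the factor `16 * c`; the argument 15 below stands for
-- `R = suc 15`.
mainTheorem5 = 2 , λ c → 16 * c , λ n ε →
  subst (TesterOfBandwidth n (c * ⌈log₂ n ⌉) ε) (sym (*-assoc 16 c ⌈log₂ n ⌉))
    (bandwidth-tester n (c * ⌈log₂ n ⌉) ε 15 ≤-refl)
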